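{- Consider the following algorithm for the (hyper)graphic matroid secretary problem on $\mathcal{M}[G]$, $G=(V,R)$: set $\mathrm{ALG}\gets\emptyset$, $A\gets\emptyset$, draw $s\sim\mathrm{Bin}(n,p)$; for $i=s+1,\dots,n$: if $r_i\in\mathrm{OPT}(R_i)$, let $a_i=(u_i,v_i)=\mathrm{arc}(r_i,\mathrm{OPT}(R_i))$, and if $\deg^-_A(u_i)=0=\deg^-_A(v_i)$ set $\mathrm{ALG}\gets\mathrm{ALG}+r_i$ and $A\gets A+a_i$; return $\mathrm{ALG}$. This algorithm has forbidden sets of size $2$. With $p=1/2$ it is $4$ probability-competitive for both graphic and hypergraphic matroids.
   Context: Hypergraphic matroid of a hypergraph $G=(V,R)$ ($|R|=n$): $X\subseteq R$ is independent iff one can choose, for each $r\in X$, a pair $\mathrm{edge}(r,X)=\{u(r),v(r)\}\subseteq r$ of vertices, all distinct over $r\in X$, forming a forest on $V$. For each independent $X$ such a choice is fixed canonically (independent of the arrival order); when $G$ is a graph, $\mathrm{edge}(r,X)=r$ (this is the graphic matroid: $X$ independent iff $(V,X)$ is a forest). The canonical orientation $\mathrm{arc}(X)$ is obtained by orienting each connected component of the forest $\{\mathrm{edge}(r,X):r\in X\}$ away from a (canonically chosen) root, so every vertex has indegree at most $1$; $\mathrm{arc}(r,X)$ is the oriented version of $\mathrm{edge}(r,X)$. $\deg^-_A(v)$ is the indegree of $v$ in arc set $A$. Ordinal MSP setting: total order $\succ$ on $R$; $\mathrm{OPT}(Q)$ is the greedy (lexicographically maximum w.r.t. $\succ$) base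 of $Q\subseteq R$, $\mathrm{OPT}=\mathrm{OPT}(R)$; edges arrive in uniformly random order $r_1,\dots,r_n$, $R_t=\{r_1,\dots,r_t\}$. Probability-competitive: $\Pr(e\in\mathrm{ALG})\ge1/\alpha$ for all $e\in\mathrm{OPT}$. Forbidden sets of size $k$: (1) output always independent; (2) draws $s\sim\mathrm{Bin}(n,p)$ and accepts none of the first $s$ elements; (3) for every $(X,Y,r^*)$ with $Y\subseteq R$, $r^*\in\mathrm{OPT}(Y)$, $X\subseteq Y\setminus\{r^*\}$ there is $\mathcal{F}(X,Y,r^*)\subseteq X$ with at most $k$ elements such that for every $t\ge s+1$, if $r_t\in\mathrm{OPT}(R_t)$ and $r_j\notin\mathcal{F}(R_j,R_t,r_t)$ for all $j\in\{s+1,\dots,t-1\}$ then $r_t$ is selected. -}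

module Defs where

open import Data.Nat as ℕ using (ℕ; zero; suc; _+_; _*_; _^_; _≤_; _<_; _<?_)
open import Data.Nat.Combinatorics using (_C_)
open import Data.Fin as Fin using (Fin; zero; suc; toℕ; inject₁; fromℕ)
open import Data.Fin.Subset using (Subset; _∈_; _∉_; _⊆_; ⁅_⁆; _∪_; ∣_∣)
  renaming (⊥ to ∅; ⊤ to full)
open import Data.Fin.Subset.Properties using (_∈?_)
open import Data.Vec as Vec using (Vec; toList; lookup)
open import Data.List as List
  using (List; []; _∷_; [_]; foldl; foldr; take; filter; length; map; concatMap; allFin; upTo)
open import Data.List.Relation.Unary.Unique.Propositional using (Unique)
import Data.List.Relation.Unary.Unique.DecPropositional as DU
open import Data.Nat.ListAction using (sum)
open import Data.Product using (Σ; ∃; _×_; _,_; proj₁; proj₂; swap)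
open import Data.Sum using (_⊎_)
open import Data.Bool using (Bool; if_then_else_; _∧_)
open import Relation.Nullary using (¬_; Dec; does)
open import Relation.Binary.PropositionalEquality using (_≡_; _≢_)

Pair : ℕ → Set
Pair m = Fin m × Fin m

Hypergraph : ℕ → ℕ → Set
Hypergraph m n = Fin n → Subset m

record ClosedTrail {m n : ℕ} (X : Subset n) (e : Fin n → Pair m) : Set where
  field
    k        : ℕ
    edge     : Fin (suc k) → Fin n
    edge-inj : ∀ i j → edge i ≡ edge j → i ≡ j
    edge-in  : ∀ i → edge i ∈ X
    vert     : Fin (suc (suc k)) → Fin m
    closed   : vert zero ≡ vert (fromℕ (suc k))
    joins    : ∀ i → (e (edge i) ≡ (vert (inject₁ i) , vert (suc i)))
                   ⊎ (e (edge i) ≡ (vert (suc i) , vert (inject₁ i)))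

Forest : {m n : ℕ} → Subset n → (Fin n → Pair m) → Set
Forest X e = ¬ ClosedTrail X e

ValidChoice : {m n : ℕ} → Hypergraph m n → Subset n → (Fin n → Pair m) → Set
ValidChoice H X e =
    (∀ r → r ∈ X → (proj₁ (e r) ∈ H r) × (proj₂ (e r) ∈ H r) × (proj₁ (e r) ≢ proj₂ (e r)))
  × (∀ r r' → r ∈ X → r' ∈ X → r ≢ r' → (e r ≢ e r') × (e r ≢ swap (e r')))
  × Forest X e

Independent : {m n : ℕ} → Hypergraph m n → Subset n → Set
Independent H X = Σ _ (ValidChoice H X)

IndepDecider : {m n : ℕ} → Hypergraph m n → Set
IndepDecider {n = n} H = (X : Subset n) → Dec (Independent H X)

indeg : {m : ℕ} → List (Pair m) → Fin m → ℕ
indeg A v = length (filter (λ a → proj₂ a Fin.≟ v) A)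

arcsOf : {m n : ℕ} → (Subset n → Fin n → Pair m) → Subset n → List (Pair m)
arcsOf {n = n} arcF X = map (arcF X) (filter (_∈? X) (allFin n))

-- arcF X r = arc(r, X): for every independent X, the pairs arcF X form a
-- valid choice edge(·, X), oriented so that every vertex has indegree ≤ 1
-- (i.e. each tree component is oriented away from a root).
ValidArcs : {m n : ℕ} → Hypergraph m n → (Subset n → Fin n → Pair m) → Set
ValidArcs {m} {n} H arcF =
  (X : Subset n) → Independent H X →
    ValidChoice H X (arcF X) × ((v : Fin m) → indeg (arcsOf arcF X) v ≤ 1)

-- Greedy optimum w.r.t. the total order given by the list `ord`
-- (ord lists R from best to worst).

module _ {m n : ℕ} (H : Hypergraph m n) (dec : IndepDecider H)
         (ord : Vec (Fin n) n) where

  OPT : Subset n → Subset n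
  OPT Q = foldl step ∅ (toList ord)
    where
    step : Subset n → Fin n → Subset n
    step B r = if does (r ∈? Q) ∧ does (dec (B ∪ ⁅ r ⁆)) then B ∪ ⁅ r ⁆ else B

  prefixSet : Vec (Fin n) n → ℕ → Subset n
  prefixSet π i = foldr (λ x S → ⁅ x ⁆ ∪ S) ∅ (take i (toList π))

  record State : Set where
    constructor ⟨_,_⟩
    field
      alg  : Subset n
      arcs : List (Pair m)

  module _ (arcF : Subset n → Fin n → Pair m) where

    -- The algorithm, for arrival order π (r_i = lookup π (i-1)) and sample size s.
    module Run (π : Vec (Fin n) n) (s : ℕ) where
      stepAt : ℕ → Fin n → State → State
      stepAt i r ⟨ ALG , A ⟩ =
        if does (s <? i) ∧ does (r ∈? O)
           ∧ does (indeg A (proj₁ a) ℕ.≟ 0) ∧ does (indeg A (proj₂ a) ℕ.≟ 0)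
        then ⟨ ALG ∪ ⁅ r ⁆ , a ∷ A ⟩ else ⟨ ALG , A ⟩
        where
        O = OPT (prefixSet π i)
        a = arcF O r

      go : ℕ → List (Fin n) → State → State
      go i []       st = st
      go i (r ∷ rs) st = go (suc i) rs (stepAt i r st)

    ALG : Vec (Fin n) n → ℕ → Subset n
    ALG π s = State.alg (Run.go π s 1 (toList π) ⟨ ∅ , [] ⟩)

    HasForbiddenSets : ℕ → Set
    HasForbiddenSets k =
        ((π : Vec (Fin n) n) → Unique (toList π) → (s : ℕ) → s ≤ n →
           Independent H (ALG π s))
      × ((π : Vec (Fin n) n) → Unique (toList π) → (s : ℕ) → s ≤ n →
           (t : Fin n) → toℕ t < s → lookup π t ∉ ALG π s)
      × ∃ λ (F : Subset n → Subset n → Fin n → Subset n) →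
          ((X Y : Subset n) (r* : Fin n) → r* ∈ OPT Y → X ⊆ Y → r* ∉ X →
              (F X Y r* ⊆ X) × (∣ F X Y r* ∣ ≤ k))
        × ((π : Vec (Fin n) n) → Unique (toList π) → (s : ℕ) → s ≤ n →
           (t : Fin n) → s ≤ toℕ t →
           lookup π t ∈ OPT (prefixSet π (suc (toℕ t))) →
           ((j : Fin n) → s ≤ toℕ j → toℕ j < toℕ t →
              lookup π j ∉ F (prefixSet π (suc (toℕ j)))
                             (prefixSet π (suc (toℕ t))) (lookup π t)) →
           lookup π t ∈ ALG π s)

-- Finite probability space: uniformly random arrival order (all
-- permutations of R) and s ~ Bin(n, 1/2) (weight n C s, total 2^n).

allVecs : (n k : ℕ) → List (Vec (Fin n) k)
allVecs n zero    = [ Vec.[] ]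
allVecs n (suc k) = concatMap (λ x → map (x Vec.∷_) (allVecs n k)) (allFin n)

perms : (n : ℕ) → List (Vec (Fin n) n)
perms n = filter (λ v → DU.unique? (Fin._≟_ {n}) (toList v)) (allVecs n n)

-- Σ_{π} Σ_{s=0}^{n} (n C s) · [e ∈ ALG π s]  ( = n!·2^n · Pr(e ∈ ALG) )
selWeight : {m n : ℕ} (H : Hypergraph m n) (dec : IndepDecider H)
            (ord : Vec (Fin n) n) (arcF : Subset n → Fin n → Pair m) → Fin n → ℕ
selWeight {n = n} H dec ord arcF e =
  sum (map (λ π → sum (map (λ s → (n C s) * (if does (e ∈? ALG H dec ord arcF π s) then 1 else 0))
                           (upTo (suc n))))
           (perms n))

-- Pr(e ∈ ALG) ≥ 1/α for every e ∈ OPT, with p = 1/2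
ProbCompetitiveHalf : {m n : ℕ} (H : Hypergraph m n) (dec : IndepDecider H)
  (ord : Vec (Fin n) n) (arcF : Subset n → Fin n → Pair m) → ℕ → Set
ProbCompetitiveHalf {n = n} H dec ord arcF α =
  (e : Fin n) → e ∈ OPT H dec ord full →
    length (perms n) * 2 ^ n ≤ α * selWeight H dec ord arcF e

{-# OPTIONS --safe #-}

-- Accepted arcs form a forest: joining u → v hangs the tree of v below u, and in a forest with
-- indegrees at most 1 the vertices of indegree 0 are the roots of distinct trees. An element r*
-- with arc (u , v) is blocked only by an accepted arc with head u or v, and arc(OPT X) contains
-- at most one arc with either head; these are the two forbidden elements.
--
-- If e ∈ OPT then e ∈ OPT(R_t) as soon as e has arrived, because hypergraphic independence is a
-- matroid: some pair chosen for the larger of two independent sets joins two components of the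
-- forest of the smaller one; if its element already belongs to the smaller set, exchanging the
-- pair of that element there makes the two choices agree on one more element.
--
-- For a fixed s ≥ 1 and n ≥ 2, revealing the order from the last element backwards shows that e
-- is selected with probability at least s (n - s) / (n (n - 1)): the last of j elements avoids two
-- forbidden ones with probability at least (j - 2) / j, and these factors telescope. Averaging
-- over s uses Σ (n C s) s (n - s) = n (n - 1) 2^(n-2).
module Submission where

open import Defs
open import Data.Bool using (true; false; if_then_else_; _∧_)
open import Data.Nat using (ℕ; zero; suc; _+_; _*_; _^_; _∸_; _!; _≤_; _<_; _<?_;
  z≤n; s≤s; s≤s⁻¹; NonZero)
open import Data.Nat.Combinatorics using (_C_; nCk+nC[k+1]≡[n+1]C[k+1]; k>n⇒nCk≡0)
open import Data.Nat.ListAction using (sum)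
open import Data.Nat.ListAction.Properties using (sum-++)
import Data.Nat.Properties as ℕ
open import Data.Nat.Tactic.RingSolver using (solve-∀)
open import Data.Fin as Fin using (Fin; zero; suc; toℕ; inject₁; fromℕ; punchIn; punchOut)
import Data.Fin.Properties as Fin
open import Data.Fin.Subset using (Subset; _∈_; _∉_; _⊆_; ⁅_⁆; _∪_; ∣_∣; _-_; _─_; inside; outside)
  renaming (⊥ to ∅; ⊤ to full)
open import Data.Fin.Subset.Properties
open import Data.Vec as Vec using (Vec; toList; []; _∷_; here; there; lookup)
import Data.Vec.Properties as Vec
open import Data.Vec.Functional using (updateAt)
open import Data.Vec.Functional.Properties using (updateAt-updates; updateAt-minimal)
open import Data.List as List
  using (List; []; _∷_; [_]; _++_; _∷ʳ_; foldl; foldr; take; filter; length; map; concatMap;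
         allFin; upTo; initLast; _∷ʳ′_)
import Data.List.Properties as List
open import Data.List.Membership.Propositional using () renaming (_∈_ to _∈ₗ_)
open import Data.List.Membership.Propositional.Properties using (∈-++⁺ˡ; ∈-++⁺ʳ; ∈-++⁻; ∈-upTo⁻)
import Data.List.Relation.Unary.All as All
import Data.List.Relation.Unary.AllPairs as AllPairs
import Data.List.Relation.Unary.Any as Any
open import Data.List.Relation.Unary.Unique.Propositional using (Unique)
import Data.List.Relation.Unary.Unique.DecPropositional as DU
import Data.List.Relation.Unary.Unique.Propositional.Properties as Unique
open import Data.Product using (∃; ∃₂; _×_; _,_; proj₁; proj₂; swap)
open import Data.Sum using (_⊎_; inj₁; inj₂; [_,_]′)
open import Data.Empty using (⊥-elim)
open import Data.Unit using () renaming (⊤ to Unit)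
open import Function using (_∘_; const; id)
open import Relation.Binary.Construct.Closure.Equivalence as EqC using (EqClosure)
open import Relation.Binary.Construct.Closure.ReflexiveTransitive using (ε; _◅_)
open import Relation.Binary.Construct.Closure.Symmetric using (fwd; bwd)
open import Relation.Binary.PropositionalEquality
  using (_≡_; _≢_; refl; sym; trans; cong; cong₂; subst; isEquivalence; module ≡-Reasoning)
open import Relation.Binary.Structures using (IsEquivalence)
open import Relation.Nullary using (¬_; Dec; yes; no; does; contradiction; ¬?; decidable-stable)
open import Relation.Nullary.Decidable using (_×-dec_; dec-true; dec-false)

private variable
  m n ℓ : ℕ
  A B : Set

-- Subsets with one element removed or added

x∉p-x : (p : Subset n) (x : Fin n) → x ∉ p - x
x∉p-x (_ ∷ p) zero    ()
x∉p-x (_ ∷ p) (suc x) (there x∈) = x∉p-x p x x∈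

p-x⊆p : (p : Subset n) (x : Fin n) → p - x ⊆ p
p-x⊆p p x = p─q⊆p p ⁅ x ⁆

suc∣p-x∣≡∣p∣ : {p : Subset n} {x : Fin n} → x ∈ p → suc ∣ p - x ∣ ≡ ∣ p ∣
suc∣p-x∣≡∣p∣ {p = inside ∷ p}  here       = cong (suc ∘ ∣_∣) (p─⊥≡p p)
suc∣p-x∣≡∣p∣ {p = inside ∷ p}  (there x∈) = cong suc (suc∣p-x∣≡∣p∣ x∈)
suc∣p-x∣≡∣p∣ {p = outside ∷ p} (there x∈) = suc∣p-x∣≡∣p∣ x∈

∣p∪⁅x⁆∣≡suc∣p∣ : {p : Subset n} {x : Fin n} → x ∉ p → ∣ p ∪ ⁅ x ⁆ ∣ ≡ suc ∣ p ∣
∣p∪⁅x⁆∣≡suc∣p∣ {p = inside ∷ p}  {zero}  x∉ = contradiction here x∉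
∣p∪⁅x⁆∣≡suc∣p∣ {p = outside ∷ p} {zero}  x∉ = cong (suc ∘ ∣_∣) (∪-identityʳ p)
∣p∪⁅x⁆∣≡suc∣p∣ {p = inside ∷ p}  {suc x} x∉ = cong suc (∣p∪⁅x⁆∣≡suc∣p∣ (x∉ ∘ there))
∣p∪⁅x⁆∣≡suc∣p∣ {p = outside ∷ p} {suc x} x∉ = ∣p∪⁅x⁆∣≡suc∣p∣ (x∉ ∘ there)

x∈p⇒x∈p∪⁅y⁆ : {p : Subset n} {x y : Fin n} → x ∈ p → x ∈ p ∪ ⁅ y ⁆
x∈p⇒x∈p∪⁅y⁆ = p⊆p∪q _

x∈p∪⁅x⁆ : (p : Subset n) (x : Fin n) → x ∈ p ∪ ⁅ x ⁆
x∈p∪⁅x⁆ p x = q⊆p∪q p _ (x∈⁅x⁆ x)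

x∈p∪⁅y⁆⁻ : {p : Subset n} {x y : Fin n} → x ∈ p ∪ ⁅ y ⁆ → x ∈ p ⊎ x ≡ y
x∈p∪⁅y⁆⁻ {p = p} {y = y} x∈ with x∈p∪q⁻ p ⁅ y ⁆ x∈
... | inj₁ x∈p = inj₁ x∈p
... | inj₂ x∈y = inj₂ (x∈⁅y⁆⇒x≡y y x∈y)

p∪⁅x⁆⊆q : {p q : Subset n} {x : Fin n} → p ⊆ q → x ∈ q → p ∪ ⁅ x ⁆ ⊆ q
p∪⁅x⁆⊆q p⊆q x∈q y∈ with x∈p∪⁅y⁆⁻ y∈
... | inj₁ y∈p  = p⊆q y∈p
... | inj₂ refl = x∈q

p⊆p-x∪⁅x⁆ : (p : Subset n) (x : Fin n) → p ⊆ (p - x) ∪ ⁅ x ⁆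
p⊆p-x∪⁅x⁆ p x {y} y∈p with y Fin.≟ x
... | yes refl = x∈p∪⁅x⁆ (p - x) x
... | no y≢x   = x∈p⇒x∈p∪⁅y⁆ (x∈p∧x≢y⇒x∈p-y y∈p y≢x)

-- Forests

module _ {A : Set} where

  chain-constant : ∀ {k} (f : Fin (suc k) → A) → (∀ j → f (inject₁ j) ≡ f (suc j)) →
    f zero ≡ f (fromℕ k)
  chain-constant {zero}  f eq = refl
  chain-constant {suc k} f eq = trans (eq zero) (chain-constant (f ∘ suc) (eq ∘ suc))

  -- The ends of step `i` are also joined the other way round the closed chain, through steps across
  -- which `f` does not change. The recursion moves the base point forward until it reaches step
  -- `i`.
  closed-chain : ∀ {k} (f : Fin (suc k) → A) (i : Fin k) →
    (∀ j → j ≢ i → f (inject₁ j) ≡ f (suc j)) → f zero ≡ f (fromℕ k) → f (inject₁ i) ≡ f (suc i)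
  closed-chain f zero    eq cl =
    trans cl (sym (chain-constant (f ∘ suc) λ j → eq (suc j) λ ()))
  closed-chain f (suc i) eq cl =
    closed-chain (f ∘ suc) i (λ j j≢i → eq (suc j) (j≢i ∘ Fin.suc-injective))
      (trans (sym (eq zero λ ())) cl)

mapTrail : {X Y : Subset n} {e e′ : Fin n → Pair m} (T : ClosedTrail X e) →
  (∀ i → ClosedTrail.edge T i ∈ Y) →
  (∀ i → e (ClosedTrail.edge T i) ≡ e′ (ClosedTrail.edge T i)) → ClosedTrail Y e′
mapTrail T inY eq = record
  { k = k ; edge = edge ; edge-inj = edge-inj ; edge-in = inY ; vert = vert ; closed = closed
  ; joins = λ i → [ inj₁ ∘ trans (sym (eq i)) , inj₂ ∘ trans (sym (eq i)) ]′ (joins i) }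
  where open ClosedTrail T

Forest-⊆ : {X Y : Subset n} {e : Fin n → Pair m} → Y ⊆ X → Forest X e → Forest Y e
Forest-⊆ Y⊆X forest T = forest (mapTrail T (Y⊆X ∘ ClosedTrail.edge-in T) (λ _ → refl))

ValidChoice-⊆ : {H : Hypergraph m n} {X Y : Subset n} {e : Fin n → Pair m} →
  Y ⊆ X → ValidChoice H X e → ValidChoice H Y e
ValidChoice-⊆ Y⊆X (inH , distinct , forest) =
  (λ r r∈ → inH r (Y⊆X r∈)) ,
  (λ r r′ r∈ r′∈ → distinct r r′ (Y⊆X r∈) (Y⊆X r′∈)) ,
  Forest-⊆ Y⊆X forest

Independent-⊆ : {H : Hypergraph m n} {X Y : Subset n} → Y ⊆ X → Independent H X → Independent H Y
Independent-⊆ Y⊆X (e , valid) = e , ValidChoice-⊆ Y⊆X valid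

ConstantOn : {A : Set} → Subset n → (Fin n → Pair m) → (Fin m → A) → Set
ConstantOn X e lab = ∀ r → r ∈ X → lab (proj₁ (e r)) ≡ lab (proj₂ (e r))

-- A closed trail through r would, outside r, join two vertices with different labels by edges
-- with constant label.
module _ {H : Hypergraph m n} {X : Subset n} {e : Fin n → Pair m} {r : Fin n} {a : Pair m}
         {A : Set} (lab : Fin m → A) where

  private
    e′ = updateAt e r (const a)

    e′r≡a : e′ r ≡ a
    e′r≡a = updateAt-updates r e

    e′≡e : ∀ {q} → q ≢ r → e′ q ≡ e q
    e′≡e {q} = updateAt-minimal q r e

  extendChoice : r ∉ X → ValidChoice H X e → ConstantOn X e lab →
    proj₁ a ∈ H r → proj₂ a ∈ H r → lab (proj₁ a) ≢ lab (proj₂ a) →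
    ValidChoice H (X ∪ ⁅ r ⁆) (updateAt e r (const a))
  extendChoice r∉X (inH , distinct , forest) const-lab a₁∈ a₂∈ lab≢ =
    inH′ , distinct′ , forest′
    where
    inX : ∀ {q} → q ∈ X ∪ ⁅ r ⁆ → q ≢ r → q ∈ X
    inX q∈ q≢r = [ id , ⊥-elim ∘ q≢r ]′ (x∈p∪⁅y⁆⁻ q∈)

    lab-eq : ∀ {q} → q ∈ X ∪ ⁅ r ⁆ → q ≢ r → lab (proj₁ (e′ q)) ≡ lab (proj₂ (e′ q))
    lab-eq {q} q∈ q≢r rewrite e′≡e q≢r = const-lab q (inX q∈ q≢r)

    lab≢′ : lab (proj₁ (e′ r)) ≢ lab (proj₂ (e′ r))
    lab≢′ rewrite e′r≡a = lab≢

    inH′ : ∀ q → q ∈ X ∪ ⁅ r ⁆ →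
      (proj₁ (e′ q) ∈ H q) × (proj₂ (e′ q) ∈ H q) × (proj₁ (e′ q) ≢ proj₂ (e′ q))
    inH′ q q∈ with q Fin.≟ r
    ... | yes refl rewrite e′r≡a = a₁∈ , a₂∈ , lab≢ ∘ cong lab
    ... | no q≢r rewrite e′≡e q≢r = inH q (inX q∈ q≢r)

    distinct′ : ∀ p q → p ∈ X ∪ ⁅ r ⁆ → q ∈ X ∪ ⁅ r ⁆ → p ≢ q →
      (e′ p ≢ e′ q) × (e′ p ≢ swap (e′ q))
    distinct′ p q p∈ q∈ p≢q with p Fin.≟ r | q Fin.≟ r
    ... | yes refl | yes refl = contradiction refl p≢q
    -- The new pair joins vertices with different labels and every old pair joins vertices with
    -- equal labels, so the two differ even after swapping.
    ... | yes refl | no q≢r =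
      (λ eq → lab≢′ (subst (λ z → lab (proj₁ z) ≡ lab (proj₂ z)) (sym eq) (lab-eq q∈ q≢r))) ,
      (λ eq → lab≢′ (subst (λ z → lab (proj₁ z) ≡ lab (proj₂ z)) (sym eq) (sym (lab-eq q∈ q≢r))))
    ... | no p≢r | yes refl =
      (λ eq → lab≢′ (subst (λ z → lab (proj₁ z) ≡ lab (proj₂ z)) eq (lab-eq p∈ p≢r))) ,
      (λ eq → lab≢′ (sym (subst (λ z → lab (proj₁ z) ≡ lab (proj₂ z)) eq (lab-eq p∈ p≢r))))
    ... | no p≢r | no q≢r rewrite e′≡e p≢r | e′≡e q≢r =
      distinct p q (inX p∈ p≢r) (inX q∈ q≢r) p≢q

    forest′ : Forest (X ∪ ⁅ r ⁆) e′
    forest′ T with Fin.any? (λ i → ClosedTrail.edge T i Fin.≟ r)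
    ... | no none = forest (mapTrail T
            (λ i → inX (ClosedTrail.edge-in T i) (λ eq → none (i , eq)))
            (λ i → e′≡e (λ eq → none (i , eq))))
    ... | yes (i , edge≡r) = lab≢′ (subst (λ z → lab (proj₁ (e′ z)) ≡ lab (proj₂ (e′ z))) edge≡r
            (ends i (closed-chain (lab ∘ vert) i step (cong lab closed))))
      where
      open ClosedTrail T
      ends : ∀ j → lab (vert (inject₁ j)) ≡ lab (vert (suc j)) →
        lab (proj₁ (e′ (edge j))) ≡ lab (proj₂ (e′ (edge j)))
      ends j eq with e′ (edge j) | joins j
      ... | _ | inj₁ refl = eq
      ... | _ | inj₂ refl = sym eq
      step : ∀ j → j ≢ i → lab (vert (inject₁ j)) ≡ lab (vert (suc j))
      step j j≢i with e′ (edge j) | joins j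
                    | lab-eq (edge-in j) (λ eq → j≢i (edge-inj j i (trans eq (sym edge≡r))))
      ... | _ | inj₁ refl | eq = eq
      ... | _ | inj₂ refl | eq = sym eq

-- Connectivity, simple paths and the components of a forest

Adjacent : Subset n → (Fin n → Pair m) → Fin m → Fin m → Set
Adjacent X e x y = ∃ λ r → r ∈ X × e r ≡ (x , y)

Connected : Subset n → (Fin n → Pair m) → Fin m → Fin m → Set
Connected X e = EqClosure (Adjacent X e)

module Paths {X : Subset n} {e : Fin n → Pair m} where

  Joins : Fin n → Fin m → Fin m → Set
  Joins r x y = (e r ≡ (x , y)) ⊎ (e r ≡ (y , x))

  -- Simple paths, defined together with their vertex sequence because each step asserts that its
  -- source does not recur. Simplicity supplies the distinct edges that a closed trail requires.
  mutual
    data Path : ℕ → Fin m → Fin m → Set where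
      stop : ∀ {x} → Path 0 x x
      step : ∀ {k x y z} (r : Fin n) → r ∈ X → Joins r x z → (p : Path k z y) →
             (∀ i → vert p i ≢ x) → Path (suc k) x y

    vert : ∀ {k x y} → Path k x y → Fin (suc k) → Fin m
    vert {x = x} _                  zero    = x
    vert         (step _ _ _ p _) (suc i) = vert p i

  edge : ∀ {k x y} → Path k x y → Fin k → Fin n
  edge (step r _ _ p _) zero    = r
  edge (step r _ _ p _) (suc i) = edge p i

  edge-in : ∀ {k x y} (p : Path k x y) i → edge p i ∈ X
  edge-in (step _ r∈ _ _ _) zero    = r∈
  edge-in (step _ _ _ p _)  (suc i) = edge-in p i

  vert-zero : ∀ {k x y} (p : Path k x y) → vert p zero ≡ x
  vert-zero stop             = refl
  vert-zero (step _ _ _ _ _) = refl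

  vert-last : ∀ {k x y} (p : Path k x y) → vert p (fromℕ k) ≡ y
  vert-last stop             = refl
  vert-last (step _ _ _ p _) = vert-last p

  joins : ∀ {k x y} (p : Path k x y) i → Joins (edge p i) (vert p (inject₁ i)) (vert p (suc i))
  joins (step _ _ j p _) zero rewrite vert-zero p = j
  joins (step _ _ _ p _) (suc i) = joins p i

  Joins-source : ∀ {r x y u v} → Joins r x y → Joins r u v → u ≡ x ⊎ v ≡ x
  Joins-source (inj₁ p) (inj₁ q) = inj₁ (cong proj₁ (trans (sym q) p))
  Joins-source (inj₁ p) (inj₂ q) = inj₂ (cong proj₁ (trans (sym q) p))
  Joins-source (inj₂ p) (inj₁ q) = inj₂ (cong proj₂ (trans (sym q) p))
  Joins-source (inj₂ p) (inj₂ q) = inj₁ (cong proj₂ (trans (sym q) p))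

  -- If the first edge occurred again, its source would be an end of the later occurrence, against
  -- simplicity.
  edge-inj : ∀ {k x y} (p : Path k x y) i j → edge p i ≡ edge p j → i ≡ j
  edge-inj (step _ _ _ p _) zero    zero    eq = refl
  edge-inj (step _ _ jn p x∉) zero  (suc j) refl =
    ⊥-elim ([ x∉ (inject₁ j) , x∉ (suc j) ]′ (Joins-source jn (joins p j)))
  edge-inj (step _ _ jn p x∉) (suc i) zero  refl =
    ⊥-elim ([ x∉ (inject₁ i) , x∉ (suc i) ]′ (Joins-source jn (joins p i)))
  edge-inj (step _ _ _ p _) (suc i) (suc j) eq = cong suc (edge-inj p i j eq)

  suffix : ∀ {k x y} (p : Path k x y) i → ∃ λ l → Path l (vert p i) y
  suffix {k} p@stop             zero    = k , p
  suffix {k} p@(step _ _ _ _ _) zero    = k , p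
  suffix (step _ _ _ p _)       (suc i) = suffix p i

  -- If `x` already lies on `p`, the detour is cut off and only the part of `p` from `x` onwards is
  -- kept; hence the existential length.
  cons : ∀ {k x y z} (r : Fin n) → r ∈ X → Joins r x z → Path k z y → ∃ λ l → Path l x y
  cons {x = x} r r∈ jn p with Fin.any? (λ i → vert p i Fin.≟ x)
  ... | yes (i , refl) = suffix p i
  ... | no none        = _ , step r r∈ jn p (λ i eq → none (i , eq))

  connected⇒path : ∀ {x y} → Connected X e x y → ∃ λ l → Path l x y
  connected⇒path ε = 0 , stop
  connected⇒path (fwd (r , r∈ , eq) ◅ c) = cons r r∈ (inj₁ eq) (proj₂ (connected⇒path c))
  connected⇒path (bwd (r , r∈ , eq) ◅ c) = cons r r∈ (inj₂ eq) (proj₂ (connected⇒path c))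

  -- The trail crosses `r` first, from its second end to its first, and returns along a simple path
  -- in `X`; `r ∉ X` keeps `r` from being repeated.
  closeTrail : ∀ {Y r} → X ⊆ Y → r ∈ Y → r ∉ X → Connected X e (proj₁ (e r)) (proj₂ (e r)) →
    ClosedTrail Y e
  closeTrail {Y} {r} X⊆Y r∈Y r∉X conn = record
    { k = proj₁ path ; edge = edge′ ; edge-inj = edge-inj′ ; edge-in = edge-in′ ; vert = vert′
    ; closed = sym (vert-last p) ; joins = joins′ }
    where
    path = connected⇒path conn
    p = proj₂ path
    edge′ : Fin (suc (proj₁ path)) → Fin n
    edge′ zero    = r
    edge′ (suc i) = edge p i
    edge-inj′ : ∀ i j → edge′ i ≡ edge′ j → i ≡ j
    edge-inj′ zero    zero    eq = refl
    edge-inj′ zero    (suc j) eq = contradiction (subst (_∈ X) (sym eq) (edge-in p j)) r∉X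
    edge-inj′ (suc i) zero    eq = contradiction (subst (_∈ X) eq (edge-in p i)) r∉X
    edge-inj′ (suc i) (suc j) eq = cong suc (edge-inj p i j eq)
    edge-in′ : ∀ i → edge′ i ∈ Y
    edge-in′ zero    = r∈Y
    edge-in′ (suc i) = X⊆Y (edge-in p i)
    vert′ : Fin (suc (suc (proj₁ path))) → Fin m
    vert′ zero    = proj₂ (e r)
    vert′ (suc i) = vert p i
    joins′ : ∀ i → Joins (edge′ i) (vert′ (inject₁ i)) (vert′ (suc i))
    joins′ zero    = inj₂ (cong (_, proj₂ (e r)) (sym (vert-zero p)))
    joins′ (suc i) = joins p i

-- By `constant` and `kernel` the fibres of `lab` are exactly the connected components; `rep` picks
-- a vertex in each. With `c` the number of edges, `size` is the count of components of a forest,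
-- written additively to avoid truncated subtraction.
record Labelling (X : Subset n) (e : Fin n → Pair m) (c : ℕ) : Set where
  field
    {k}      : ℕ
    lab      : Fin m → Fin k
    rep      : Fin k → Fin m
    lab-rep  : ∀ i → lab (rep i) ≡ i
    size     : m ≡ k + c
    constant : ConstantOn X e lab
    kernel   : ∀ {x y} → lab x ≡ lab y → Connected X e x y

module _ {k : ℕ} {a b : Fin (suc k)} (a≢b : a ≢ b) where

  -- The quotient of `Fin (suc k)` that identifies `a` with `b`, with `punchIn b` as a section.
  merge : Fin (suc k) → Fin k
  merge i with b Fin.≟ i
  ... | yes _  = punchOut (a≢b ∘ sym)
  ... | no b≢i = punchOut b≢i

  merge-punchIn : ∀ i → merge (punchIn b i) ≡ i
  merge-punchIn i with b Fin.≟ punchIn b i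
  ... | yes eq = contradiction (sym eq) (Fin.punchInᵢ≢i b i)
  ... | no neq = trans (Fin.punchOut-cong b refl) (Fin.punchOut-punchIn b)

  merge-ab : merge a ≡ merge b
  merge-ab with b Fin.≟ a | b Fin.≟ b
  ... | yes eq | _     = contradiction (sym eq) a≢b
  ... | no _   | no ne = contradiction refl ne
  ... | no _   | yes _ = Fin.punchOut-cong b refl

  merge-kernel : ∀ i j → merge i ≡ merge j → i ≡ j ⊎ (i ≡ b × j ≡ a) ⊎ (i ≡ a × j ≡ b)
  merge-kernel i j eq with b Fin.≟ i | b Fin.≟ j
  ... | yes refl | yes refl = inj₁ refl
  ... | yes refl | no b≢j   = inj₂ (inj₁ (refl , sym (Fin.punchOut-injective (a≢b ∘ sym) b≢j eq)))
  ... | no b≢i   | yes refl = inj₂ (inj₂ (Fin.punchOut-injective b≢i (a≢b ∘ sym) eq , refl))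
  ... | no b≢i   | no b≢j   = inj₁ (Fin.punchOut-injective b≢i b≢j eq)

-- Edges are added one at a time. Acyclicity puts the ends of `r` in different components of
-- `X - r`, so `r` merges two labels and the number of components drops by one.
labelling : ∀ c (X : Subset n) (e : Fin n → Pair m) → ∣ X ∣ ≡ c → Forest X e → Labelling X e c
labelling zero X e ∣X∣≡0 forest = record
  { lab = id ; rep = id ; lab-rep = λ _ → refl ; size = sym (ℕ.+-identityʳ _)
  ; constant = λ r r∈ → contradiction (trans (suc∣p-x∣≡∣p∣ r∈) ∣X∣≡0) λ ()
  ; kernel = λ { refl → ε } }
labelling {n} {m} (suc c) X e ∣X∣≡ forest with nonempty? X
... | no empty = contradiction
        (trans (sym ∣X∣≡) (trans (cong ∣_∣ (Empty-unique empty)) (∣⊥∣≡0 n))) λ ()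
... | yes (r , r∈X) = glue (labelling c (X - r) e
        (ℕ.suc-injective (trans (suc∣p-x∣≡∣p∣ r∈X) ∣X∣≡)) (Forest-⊆ (p-x⊆p X r) forest))
  where
  u = proj₁ (e r)
  v = proj₂ (e r)
  weaken : ∀ {x y} → Connected (X - r) e x y → Connected X e x y
  weaken = EqC.map λ (q , q∈ , eq) → q , p-x⊆p X r q∈ , eq
  u~v : Connected X e u v
  u~v = EqC.return (r , r∈X , refl)
  open IsEquivalence (EqC.isEquivalence (Adjacent X e)) using ()
    renaming (trans to _⨾_; sym to flip)
  glue : Labelling (X - r) e c → Labelling X e (suc c)
  glue record { k = zero ; lab = lab } = contradiction (lab u) Fin.¬Fin0
  glue record { k = suc k′ ; lab = lab ; rep = rep ; lab-rep = lab-rep ; size = size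
              ; constant = constant ; kernel = kernel } = record
    { lab = merge lab≢ ∘ lab ; rep = rep ∘ punchIn (lab v)
    ; lab-rep = λ i → trans (cong (merge lab≢) (lab-rep _)) (merge-punchIn lab≢ i)
    ; size = trans size (sym (ℕ.+-suc k′ c))
    ; constant = constant′ ; kernel = kernel′ }
    where
    lab≢ : lab u ≢ lab v
    lab≢ eq = forest (Paths.closeTrail (p-x⊆p X r) r∈X (x∉p-x X r) (kernel eq))
    constant′ : ConstantOn X e (merge lab≢ ∘ lab)
    constant′ q q∈ with q Fin.≟ r
    ... | yes refl = merge-ab lab≢
    ... | no q≢r   = cong (merge lab≢) (constant q (x∈p∧x≢y⇒x∈p-y q∈ q≢r))
    kernel′ : ∀ {x y} → merge lab≢ (lab x) ≡ merge lab≢ (lab y) → Connected X e x y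
    kernel′ {x} {y} eq with merge-kernel lab≢ (lab x) (lab y) eq
    ... | inj₁ x~y = weaken (kernel x~y)
    ... | inj₂ (inj₁ (x~v , y~u)) = weaken (kernel x~v) ⨾ (flip u~v ⨾ weaken (kernel (sym y~u)))
    ... | inj₂ (inj₂ (x~u , y~v)) = weaken (kernel x~u) ⨾ (u~v ⨾ weaken (kernel (sym y~v)))

-- If every edge of the larger forest J joined vertices of one component of I, then the
-- components of I would inject into the fewer components of J.
crossingEdge : {I J : Subset n} {f g : Fin n → Pair m} (L : Labelling I f ∣ I ∣) →
  Forest J g → ∣ I ∣ < ∣ J ∣ → let open Labelling L in
  ∃ λ y → y ∈ J × lab (proj₁ (g y)) ≢ lab (proj₂ (g y))
crossingEdge {I = I} {J} {f} {g} L forestJ I<J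
  with Fin.any? (λ y → (y ∈? J) ×-dec
         ¬? (Labelling.lab L (proj₁ (g y)) Fin.≟ Labelling.lab L (proj₂ (g y))))
... | yes found = found
... | no none = contradiction I<J (ℕ.≤⇒≯ (ℕ.+-cancelˡ-≤ LI.k _ _ (ℕ.≤-trans
        (ℕ.+-monoˡ-≤ ∣ J ∣ (Fin.injective⇒≤ {f = LJ.lab ∘ LI.rep} inj))
        (ℕ.≤-reflexive (trans (sym LJ.size) LI.size)))))
  where
  module LI = Labelling L
  module LJ = Labelling (labelling ∣ J ∣ J g refl forestJ)
  refine : ∀ {x y} → Connected J g x y → LI.lab x ≡ LI.lab y
  refine = EqC.gfold isEquivalence LI.lab λ (r , r∈ , eq) →
    subst (λ a → LI.lab (proj₁ a) ≡ LI.lab (proj₂ a)) eq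
      (decidable-stable (_ Fin.≟ _) λ neq → none (r , r∈ , neq))
  inj : ∀ {i j} → LJ.lab (LI.rep i) ≡ LJ.lab (LI.rep j) → i ≡ j
  inj {i} {j} eq = trans (sym (LI.lab-rep i)) (trans (refine (LJ.kernel eq)) (LI.lab-rep j))

-- Matroid augmentation for hypergraphic independence

module Matroid (H : Hypergraph m n) where

  -- Replacing the pair f y of an element y ∈ I by the crossing pair g y brings the
  -- representation f of I closer to the representation g of J; U bounds where they differ.
  augmentChoice : ∀ d {I J : Subset n} {f g : Fin n → Pair m} (U : Subset n) → ∣ U ∣ ≤ d →
    (∀ r → r ∉ U → f r ≡ g r) → ValidChoice H I f → ValidChoice H J g → ∣ I ∣ < ∣ J ∣ →
    ∃ λ y → y ∈ J × y ∉ I × Independent H (I ∪ ⁅ y ⁆)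
  augmentChoice d {I} {J} {f} {g} U ∣U∣≤d agree vI vJ I<J = go d ∣U∣≤d
    where
    L = labelling ∣ I ∣ I f refl (proj₂ (proj₂ vI))
    open Labelling L using (lab; constant)
    cross = crossingEdge L (proj₂ (proj₂ vJ)) I<J
    y = proj₁ cross
    y∈J = proj₁ (proj₂ cross)
    lab≢ = proj₂ (proj₂ cross)
    gy∈H = proj₁ vJ y y∈J
    -- Applied with `X = I` to finish, and with `X = I - y` to exchange the pair of `y`.
    extend : ∀ X → X ⊆ I → y ∉ X → ValidChoice H (X ∪ ⁅ y ⁆) (updateAt f y (const (g y)))
    extend X X⊆I y∉X = extendChoice lab y∉X (ValidChoice-⊆ X⊆I vI) (λ r r∈ → constant r (X⊆I r∈))
      (proj₁ gy∈H) (proj₁ (proj₂ gy∈H)) lab≢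
    go : ∀ d → ∣ U ∣ ≤ d → ∃ λ y → y ∈ J × y ∉ I × Independent H (I ∪ ⁅ y ⁆)
    go d ∣U∣≤d with y ∈? I
    ... | no y∉I = y , y∈J , y∉I , _ , extend I id y∉I
    ... | yes y∈I with y ∈? U
    ...   | no y∉U = contradiction
              (subst (λ a → lab (proj₁ a) ≡ lab (proj₂ a)) (agree y y∉U) (constant y y∈I)) lab≢
    ...   | yes y∈U with d
    ...     | zero = contradiction (ℕ.≤-trans (ℕ.≤-reflexive (suc∣p-x∣≡∣p∣ y∈U)) ∣U∣≤d) λ ()
    ...     | suc d′ = augmentChoice d′ (U - y)
                (s≤s⁻¹ (ℕ.≤-trans (ℕ.≤-reflexive (suc∣p-x∣≡∣p∣ y∈U)) ∣U∣≤d)) agree′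
                (ValidChoice-⊆ (p⊆p-x∪⁅x⁆ I y) (extend (I - y) (p-x⊆p I y) (x∉p-x I y))) vJ I<J
      where
      agree′ : ∀ r → r ∉ U - y → updateAt f y (const (g y)) r ≡ g r
      agree′ r r∉ with r Fin.≟ y
      ... | yes refl = updateAt-updates y f
      ... | no r≢y = trans (updateAt-minimal r y f r≢y)
                           (agree r λ r∈U → r∉ (x∈p∧x≢y⇒x∈p-y r∈U r≢y))

  augment : {I J : Subset n} → Independent H I → Independent H J → ∣ I ∣ < ∣ J ∣ →
    ∃ λ y → y ∈ J × y ∉ I × Independent H (I ∪ ⁅ y ⁆)
  augment (_ , vI) (_ , vJ) =
    augmentChoice _ full ℕ.≤-refl (λ r r∉ → contradiction ∈⊤ r∉) vI vJ

  -- Augmentation is repeated until the size of `J` is reached; `d` bounds the number of rounds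
  -- still required.
  augmentTo : ∀ d {I J : Subset n} → Independent H I → Independent H J → ∣ J ∣ ≤ d + ∣ I ∣ →
    ∃ λ K → I ⊆ K × (∀ {y} → y ∈ K → y ∈ I ⊎ y ∈ J) × Independent H K × ∣ J ∣ ≤ ∣ K ∣
  augmentTo zero    {I} indI indJ J≤ = I , id , inj₁ , indI , J≤
  augmentTo (suc d) {I} {J} indI indJ J≤ with ∣ I ∣ ℕ.<? ∣ J ∣
  ... | no I≮J = I , id , inj₁ , indI , ℕ.≮⇒≥ I≮J
  ... | yes I<J with augment indI indJ I<J
  ...   | y , y∈J , y∉I , indI′
    with augmentTo d indI′ indJ (ℕ.≤-trans J≤ (ℕ.≤-reflexive
           (trans (sym (ℕ.+-suc d _)) (cong (d +_) (sym (∣p∪⁅x⁆∣≡suc∣p∣ y∉I))))))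
  ...   | K , I′⊆K , K⊆ , indK , J≤K = K , I′⊆K ∘ x∈p⇒x∈p∪⁅y⁆ , K⊆I∪J , indK , J≤K
    where
    K⊆I∪J : ∀ {z} → z ∈ K → z ∈ I ⊎ z ∈ J
    K⊆I∪J z∈ with K⊆ z∈
    ... | inj₂ z∈J = inj₂ z∈J
    ... | inj₁ z∈I′ with x∈p∪⁅y⁆⁻ z∈I′
    ...   | inj₁ z∈I  = inj₁ z∈I
    ...   | inj₂ refl = inj₂ y∈J

  -- Otherwise, extending B′ inside B′ ∪ B ∪ ⁅ x ⁆ to size ∣ B ∣ + 1 yields an independent set
  -- avoiding x from which B can be augmented by an element of B′.
  spanMonotone : {B B′ : Subset n} {x : Fin n} → Independent H (B ∪ ⁅ x ⁆) → Independent H B′ →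
    (∀ {y} → y ∈ B′ → y ∈ B ⊎ ¬ Independent H (B ∪ ⁅ y ⁆)) → x ∉ B → Independent H (B′ ∪ ⁅ x ⁆)
  spanMonotone {B} {B′} {x} indBx indB′ spanned x∉B
    with augmentTo ∣ B ∪ ⁅ x ⁆ ∣ indB′ indBx (ℕ.m≤m+n _ _)
  ... | K , B′⊆K , K⊆ , indK , Bx≤K with x ∈? K
  ... | yes x∈K = Independent-⊆ (p∪⁅x⁆⊆q B′⊆K x∈K) indK
  ... | no x∉K
    with augment (Independent-⊆ x∈p⇒x∈p∪⁅y⁆ indBx) indK
           (ℕ.≤-trans (ℕ.≤-reflexive (sym (∣p∪⁅x⁆∣≡suc∣p∣ x∉B))) Bx≤K)
  ... | y , y∈K , y∉B , indBy with K⊆ y∈K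
  ... | inj₁ y∈B′ = contradiction indBy ([ ⊥-elim ∘ y∉B , id ]′ (spanned y∈B′))
  ... | inj₂ y∈Bx with x∈p∪⁅y⁆⁻ y∈Bx
  ...   | inj₁ y∈B  = contradiction y∈B y∉B
  ...   | inj₂ refl = contradiction y∈K x∉K

-- The greedy base and its restriction to subsets

if-∧-elim : {S A B : Set} (P : S → Set) (p : Dec A) (q : Dec B) {x y : S} →
  (A → B → P x) → (¬ (A × B) → P y) → P (if does p ∧ does q then x else y)
if-∧-elim P (yes a) (yes b) t f = t a b
if-∧-elim P (yes _) (no ¬b) t f = f (¬b ∘ proj₂)
if-∧-elim P (no ¬a) _       t f = f (¬a ∘ proj₁)

foldl-≗ : {A B : Set} {f g : A → B → A} → (∀ a b → f a b ≡ g a b) → ∀ a xs →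
  foldl f a xs ≡ foldl g a xs
foldl-≗ eq a []       = refl
foldl-≗ {g = g} eq a (x ∷ xs) = trans (cong (λ z → foldl _ z xs) (eq a x)) (foldl-≗ eq (g a x) xs)

module Greedy (H : Hypergraph m n) (dec : IndepDecider H) (ord : Vec (Fin n) n) where
  open Matroid H

  -- Repeats the step function local to `OPT`, so that inductions over the greedy run can refer to
  -- it.
  greedyStep : Subset n → Subset n → Fin n → Subset n
  greedyStep Q B r = if does (r ∈? Q) ∧ does (dec (B ∪ ⁅ r ⁆)) then B ∪ ⁅ r ⁆ else B

  OPT≡foldl : ∀ Q → OPT H dec ord Q ≡ foldl (greedyStep Q) ∅ (toList ord)
  OPT≡foldl Q = foldl-≗ (λ _ _ → refl) ∅ (toList ord)

  OPT-induction : ∀ Q (P : Subset n → Set) → P ∅ →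
    (∀ {B r} → P B → r ∈ Q → Independent H (B ∪ ⁅ r ⁆) → P (B ∪ ⁅ r ⁆)) → P (OPT H dec ord Q)
  OPT-induction Q P base ext rewrite OPT≡foldl Q = go ∅ (toList ord) base
    where
    go : ∀ B rs → P B → P (foldl (greedyStep Q) B rs)
    go B []       pB = pB
    go B (r ∷ rs) pB = go _ rs
      (if-∧-elim P (r ∈? Q) (dec (B ∪ ⁅ r ⁆)) (ext pB) (λ _ → pB))

  OPT⊆ : ∀ Q → OPT H dec ord Q ⊆ Q
  OPT⊆ Q = OPT-induction Q (_⊆ Q) (λ x∈ → contradiction x∈ ∉⊥)
    (λ B⊆Q r∈Q _ → p∪⁅x⁆⊆q B⊆Q r∈Q)

  OPT-independent : Independent H ∅ → ∀ Q → Independent H (OPT H dec ord Q)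
  OPT-independent ind∅ Q = OPT-induction Q (Independent H) ind∅ (λ _ _ ind → ind)

  -- Invariant of two greedy runs over the same order: `B` comes from the run on all elements, `B′`
  -- from the run on `Q`. The field `spanned` says that `B` spans `B′`.
  record Coupled (Q B B′ : Subset n) : Set where
    constructor coupled
    field
      indB    : Independent H B
      indB′   : Independent H B′
      spanned : ∀ {y} → y ∈ B′ → y ∈ B ⊎ ¬ Independent H (B ∪ ⁅ y ⁆)
      B∩Q⊆B′  : ∀ {y} → y ∈ B → y ∈ Q → y ∈ B′

  Coupled-step : ∀ {Q B B′} r → Coupled Q B B′ → Coupled Q (greedyStep full B r) (greedyStep Q B′ r)
  Coupled-step {Q} {B} {B′} r (coupled indB indB′ spanned B∩Q⊆B′) =
    if-∧-elim (λ X → Coupled Q X (greedyStep Q B′ r)) (r ∈? full) (dec (B ∪ ⁅ r ⁆)) added rejected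
    where
    mono : {X : Subset n} → B ⊆ X → ∀ {y} → y ∈ B ⊎ ¬ Independent H (B ∪ ⁅ y ⁆) →
      y ∈ X ⊎ ¬ Independent H (X ∪ ⁅ y ⁆)
    mono B⊆X (inj₁ y∈B)  = inj₁ (B⊆X y∈B)
    mono B⊆X (inj₂ dep) = inj₂ (dep ∘ Independent-⊆ (p∪⁅x⁆⊆q (x∈p⇒x∈p∪⁅y⁆ ∘ B⊆X) (x∈p∪⁅x⁆ _ _)))

    added : r ∈ full → Independent H (B ∪ ⁅ r ⁆) → Coupled Q (B ∪ ⁅ r ⁆) (greedyStep Q B′ r)
    added _ indBr = if-∧-elim (Coupled Q (B ∪ ⁅ r ⁆)) (r ∈? Q) (dec (B′ ∪ ⁅ r ⁆))
      (λ r∈Q indB′r → coupled indBr indB′r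
        (λ y∈ → [ mono x∈p⇒x∈p∪⁅y⁆ ∘ spanned , (λ { refl → inj₁ (x∈p∪⁅x⁆ B r) }) ]′ (x∈p∪⁅y⁆⁻ y∈))
        (λ y∈ y∈Q → [ (λ y∈B → x∈p⇒x∈p∪⁅y⁆ (B∩Q⊆B′ y∈B y∈Q))
                    , (λ { refl → x∈p∪⁅x⁆ B′ r }) ]′ (x∈p∪⁅y⁆⁻ y∈)))
      (λ not-added → coupled indBr indB′ (mono x∈p⇒x∈p∪⁅y⁆ ∘ spanned)
        (λ y∈ y∈Q → [ (λ y∈B → B∩Q⊆B′ y∈B y∈Q) , (λ { refl → r∈B′ not-added y∈Q }) ]′ (x∈p∪⁅y⁆⁻ y∈)))
      where
      -- An element of `Q` new to `B` is independent of `B′` as well, by `spanMonotone`, so the run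
      -- on `Q` cannot have refused it.
      r∈B′ : ¬ (r ∈ Q × Independent H (B′ ∪ ⁅ r ⁆)) → r ∈ Q → r ∈ B′
      r∈B′ not-added r∈Q with r ∈? B
      ... | yes r∈B = B∩Q⊆B′ r∈B r∈Q
      ... | no r∉B  = contradiction (r∈Q , spanMonotone indBr indB′ spanned r∉B) not-added

    -- Since `r` lies in `full`, the refusal means that `B ∪ ⁅ r ⁆` is dependent, which is what
    -- `spanned` asks if `r` enters `B′`.
    rejected : ¬ (r ∈ full × Independent H (B ∪ ⁅ r ⁆)) → Coupled Q B (greedyStep Q B′ r)
    rejected rej = if-∧-elim (Coupled Q B) (r ∈? Q) (dec (B′ ∪ ⁅ r ⁆))
      (λ r∈Q indB′r → coupled indB indB′r
        (λ y∈ → [ spanned , (λ { refl → inj₂ (λ ind → rej (∈⊤ , ind)) }) ]′ (x∈p∪⁅y⁆⁻ y∈))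
        (λ y∈B y∈Q → x∈p⇒x∈p∪⁅y⁆ (B∩Q⊆B′ y∈B y∈Q)))
      (λ _ → coupled indB indB′ spanned B∩Q⊆B′)

  OPT-hereditary : Independent H ∅ → ∀ {Q r} → r ∈ OPT H dec ord full → r ∈ Q → r ∈ OPT H dec ord Q
  OPT-hereditary ind∅ {Q} r∈OPT r∈Q rewrite OPT≡foldl full | OPT≡foldl Q =
    Coupled.B∩Q⊆B′ (go (toList ord)
      (coupled ind∅ ind∅ (λ y∈ → contradiction y∈ ∉⊥) (λ y∈ _ → y∈))) r∈OPT r∈Q
    where
    go : ∀ {B B′} rs → Coupled Q B B′ →
      Coupled Q (foldl (greedyStep full) B rs) (foldl (greedyStep Q) B′ rs)
    go []       c = c
    go (r ∷ rs) c = go rs (Coupled-step r c)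

-- The algorithm and its forbidden sets

∈-toList : (v : Vec A ℓ) (i : Fin ℓ) → lookup v i ∈ₗ toList v
∈-toList (x ∷ v) zero    = Any.here refl
∈-toList (x ∷ v) (suc i) = Any.there (∈-toList v i)

lookup-injective : (v : Vec A ℓ) → Unique (toList v) → ∀ i j →
  lookup v i ≡ lookup v j → i ≡ j
lookup-injective (x ∷ v) (x∉ AllPairs.∷ u) zero    zero    eq = refl
lookup-injective (x ∷ v) (x∉ AllPairs.∷ u) zero    (suc j) eq =
  contradiction eq (All.lookup x∉ (∈-toList v j))
lookup-injective (x ∷ v) (x∉ AllPairs.∷ u) (suc i) zero    eq =
  contradiction (sym eq) (All.lookup x∉ (∈-toList v i))
lookup-injective (x ∷ v) (x∉ AllPairs.∷ u) (suc i) (suc j) eq =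
  cong suc (lookup-injective v u i j eq)

setOf : List (Fin n) → Subset n
setOf = foldr (λ x S → ⁅ x ⁆ ∪ S) ∅

∈-setOf⁺ : {x : Fin n} {l : List (Fin n)} → x ∈ₗ l → x ∈ setOf l
∈-setOf⁺ (Any.here refl) = p⊆p∪q _ (x∈⁅x⁆ _)
∈-setOf⁺ (Any.there x∈)  = q⊆p∪q _ _ (∈-setOf⁺ x∈)

∈-setOf⁻ : {x : Fin n} (l : List (Fin n)) → x ∈ setOf l → x ∈ₗ l
∈-setOf⁻ []      x∈ = contradiction x∈ ∉⊥
∈-setOf⁻ (y ∷ l) x∈ with x∈p∪q⁻ ⁅ y ⁆ (setOf l) x∈
... | inj₁ x∈y = Any.here (x∈⁅y⁆⇒x≡y y x∈y)
... | inj₂ x∈l = Any.there (∈-setOf⁻ l x∈l)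

lookup∈prefix : (v : Vec (Fin n) ℓ) (j : Fin ℓ) {i : ℕ} → toℕ j < i →
  lookup v j ∈ setOf (take i (toList v))
lookup∈prefix (x ∷ v) zero    (s≤s _)   = p⊆p∪q _ (x∈⁅x⁆ x)
lookup∈prefix (x ∷ v) (suc j) (s≤s j<i) = q⊆p∪q ⁅ x ⁆ _ (lookup∈prefix v j j<i)

∣p∪q∣≤∣p∣+∣q∣ : (p q : Subset n) → ∣ p ∪ q ∣ ≤ ∣ p ∣ + ∣ q ∣
∣p∪q∣≤∣p∣+∣q∣ []            []            = z≤n
∣p∪q∣≤∣p∣+∣q∣ (outside ∷ p) (outside ∷ q) = ∣p∪q∣≤∣p∣+∣q∣ p q
∣p∪q∣≤∣p∣+∣q∣ (outside ∷ p) (inside ∷ q)  =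
  ℕ.≤-trans (s≤s (∣p∪q∣≤∣p∣+∣q∣ p q)) (ℕ.≤-reflexive (sym (ℕ.+-suc ∣ p ∣ ∣ q ∣)))
∣p∪q∣≤∣p∣+∣q∣ (inside ∷ p)  (outside ∷ q) = s≤s (∣p∪q∣≤∣p∣+∣q∣ p q)
∣p∪q∣≤∣p∣+∣q∣ (inside ∷ p)  (inside ∷ q)  =
  s≤s (ℕ.≤-trans (∣p∪q∣≤∣p∣+∣q∣ p q) (ℕ.+-monoʳ-≤ ∣ p ∣ (ℕ.n≤1+n ∣ q ∣)))

module _ {P : Fin n → Set} (P? : ∀ x → Dec (P x)) where

  comprehension : Subset n
  comprehension = Vec.tabulate (λ x → does (P? x))

  ∈-comprehension⁺ : ∀ {x} → P x → x ∈ comprehension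
  ∈-comprehension⁺ {x} px =
    Vec.lookup⇒[]= x _ (trans (Vec.lookup∘tabulate (does ∘ P?) x) (dec-true (P? x) px))

  ∈-comprehension⁻ : ∀ {x} → x ∈ comprehension → P x
  ∈-comprehension⁻ {x} x∈
    with P? x | trans (sym (Vec.lookup∘tabulate (does ∘ P?) x)) (Vec.[]=⇒lookup x∈)
  ... | yes px | _  = px
  ... | no _   | ()

indeg-∷ : (A : List (Pair m)) (a : Pair m) (w : Fin m) →
  (proj₂ a ≡ w) ⊎ (indeg (a ∷ A) w ≡ indeg A w × proj₂ a ≢ w)
indeg-∷ A a w with proj₂ a Fin.≟ w
... | yes eq = inj₁ eq
... | no neq = inj₂ (refl , neq)

module _ (arcF : Subset n → Fin n → Pair m) where

  hasHead? : ∀ X w r → Dec (r ∈ X × proj₂ (arcF X r) ≡ w)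
  hasHead? X w r = (r ∈? X) ×-dec (proj₂ (arcF X r) Fin.≟ w)

  withHead : Subset n → Fin m → Subset n
  withHead X w = comprehension (hasHead? X w)

  ∣withHead∣≡indeg : ∀ X w → ∣ withHead X w ∣ ≡ indeg (arcsOf arcF X) w
  ∣withHead∣≡indeg X w = go _ id
    where
    -- Generalised from `id` to any `f`, because the tail of a list tabulated by `f` is tabulated by
    -- `f ∘ suc`.
    go : ∀ k (f : Fin k → Fin n) → ∣ Vec.tabulate (λ i → does (hasHead? X w (f i))) ∣ ≡
      indeg (map (arcF X) (filter (_∈? X) (List.tabulate f))) w
    go zero    f = refl
    go (suc k) f with f zero ∈? X
    ... | no _ = go k (f ∘ suc)
    ... | yes _ with proj₂ (arcF X (f zero)) Fin.≟ w
    ...   | yes _ = cong suc (go k (f ∘ suc))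
    ...   | no _  = go k (f ∘ suc)

module Forbidden (H : Hypergraph m n) (dec : IndepDecider H) (ord : Vec (Fin n) n)
                 (arcF : Subset n → Fin n → Pair m) (validArcs : ValidArcs H arcF) where
  open Greedy H dec ord

  O : Subset n → Subset n
  O = OPT H dec ord

  ∅-independent : Independent H ∅
  ∅-independent = arcF ∅ , (λ _ r∈ → contradiction r∈ ∉⊥) , (λ _ _ r∈ → contradiction r∈ ∉⊥) ,
    λ T → ∉⊥ (ClosedTrail.edge-in T zero)

  O-independent : ∀ Q → Independent H (O Q)
  O-independent = OPT-independent ∅-independent

  module Order (π : Vec (Fin n) n) (unique : Unique (toList π)) (s : ℕ) where
    open Run H dec ord arcF π s

    elt : Fin n → Fin n
    elt = lookup π

    opt : Fin n → Subset n
    opt j = O (prefixSet H dec ord π (suc (toℕ j)))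

    arc : Fin n → Pair m
    arc j = arcF (opt j) (elt j)

    -- `P i` is the loop invariant after `i` arrivals. The algorithm numbers arrivals from 1 and
    -- `Fin` from 0, hence the successor passed to `go` and `stepAt`.
    go-induction : (P : ℕ → State H dec ord → Set) → ∀ i (v : Vec (Fin n) ℓ) st → P i st →
      (∀ j st → P (i + toℕ j) st →
         P (suc (i + toℕ j)) (stepAt (suc (i + toℕ j)) (lookup v j) st)) →
      P (i + ℓ) (go (suc i) (toList v) st)
    go-induction P i []      st p next rewrite ℕ.+-identityʳ i = p
    go-induction {suc k} P i (x ∷ v) st p next =
      subst (λ z → P z (go (suc (suc i)) (toList v) (stepAt (suc i) x st))) (sym (ℕ.+-suc i k))
        (go-induction P (suc i) v _
          (subst (λ z → P (suc z) (stepAt (suc z) x st)) (ℕ.+-identityʳ i)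
            (next zero st (subst (λ z → P z st) (sym (ℕ.+-identityʳ i)) p)))
          (λ j st′ p′ → subst (λ z → P (suc z) (stepAt (suc z) (lookup v j) st′)) (ℕ.+-suc i (toℕ j))
            (next (suc j) st′ (subst (λ z → P z st′) (sym (ℕ.+-suc i (toℕ j))) p′))))

    Accepts : Fin n → List (Pair m) → Set
    Accepts j A = s < suc (toℕ j) × elt j ∈ opt j × indeg A (proj₁ (arc j)) ≡ 0 ×
                  indeg A (proj₂ (arc j)) ≡ 0

    run-induction : (P : ℕ → State H dec ord → Set) → P 0 ⟨ ∅ , [] ⟩ →
      (∀ j {S A} → P (toℕ j) ⟨ S , A ⟩ → Accepts j A →
         P (suc (toℕ j)) ⟨ S ∪ ⁅ elt j ⁆ , arc j ∷ A ⟩) →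
      (∀ j {S A} → P (toℕ j) ⟨ S , A ⟩ → ¬ Accepts j A → P (suc (toℕ j)) ⟨ S , A ⟩) →
      P n (go 1 (toList π) ⟨ ∅ , [] ⟩)
    run-induction P base accept reject = go-induction P 0 π ⟨ ∅ , [] ⟩ base
      λ { j ⟨ S , A ⟩ p → if-∧-elim (P (suc (toℕ j))) (s <? suc (toℕ j))
            ((elt j ∈? opt j) ×-dec ((indeg A (proj₁ (arc j)) ℕ.≟ 0)
               ×-dec (indeg A (proj₂ (arc j)) ℕ.≟ 0)))
            (λ s<i rest → accept j p (s<i , rest)) (reject j p) }

    -- root maps every vertex to the unique vertex of indegree 0 in its component of the
    -- forest of accepted arcs.
    record Rooted (i : ℕ) (st : State H dec ord) : Set where
      open State st
      field
        choice   : Fin n → Pair m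
        valid    : ValidChoice H alg choice
        root     : Fin m → Fin m
        constant : ConstantOn alg choice root
        fixed    : ∀ w → indeg arcs w ≡ 0 → root w ≡ w
        arrival  : ∀ {r} → r ∈ alg → ∃ λ j → toℕ j < i × s ≤ toℕ j × elt j ≡ r

    rooted : Rooted n (go 1 (toList π) ⟨ ∅ , [] ⟩)
    rooted = run-induction Rooted
      (record { choice = arcF ∅ ; valid = proj₂ ∅-independent ; root = id
              ; constant = λ _ r∈ → contradiction r∈ ∉⊥ ; fixed = λ _ _ → refl
              ; arrival = λ r∈ → contradiction r∈ ∉⊥ })
      accept
      (λ j p _ → record { Rooted p ; arrival = λ r∈ →
         let j′ , j′<j , rest = Rooted.arrival p r∈ in j′ , ℕ.m≤n⇒m≤1+n j′<j , rest })
      where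
      accept : ∀ j {S A} → Rooted (toℕ j) ⟨ S , A ⟩ → Accepts j A →
        Rooted (suc (toℕ j)) ⟨ S ∪ ⁅ elt j ⁆ , arc j ∷ A ⟩
      accept j {S} {A} p (s<1+j , r∈O , indeg-u , indeg-v) = record
        { choice = updateAt choice (elt j) (const (arc j))
        -- Both ends of the new arc have indegree 0, so each is its own root; being distinct, they
        -- lie in different trees.
        ; valid = extendChoice root r∉S valid constant (proj₁ inH) (proj₁ (proj₂ inH))
            (λ eq → proj₂ (proj₂ inH) (trans (sym root-u) (trans eq root-v)))
        ; root = hang ∘ root
        ; constant = constant′
        ; fixed = fixed′
        ; arrival = λ x∈ → [ (λ x∈S → let j′ , j′<j , rest = arrival x∈S in
                                j′ , ℕ.m≤n⇒m≤1+n j′<j , rest)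
                           , (λ { refl → j , ℕ.≤-refl , s≤s⁻¹ s<1+j , refl }) ]′ (x∈p∪⁅y⁆⁻ x∈)
        }
        where
        open Rooted p
        u = proj₁ (arc j)
        v = proj₂ (arc j)
        inH : u ∈ H (elt j) × v ∈ H (elt j) × u ≢ v
        inH = proj₁ (proj₁ (validArcs (opt j) (O-independent _))) (elt j) r∈O
        root-u = fixed u indeg-u
        root-v = fixed v indeg-v
        r∉S : elt j ∉ S
        r∉S r∈S = let j′ , j′<j , _ , eq = arrival r∈S in
          ℕ.<⇒≢ j′<j (cong toℕ (lookup-injective π unique j′ j eq))
        hang : Fin m → Fin m
        hang w = if does (w Fin.≟ v) then u else w
        hang-v : hang v ≡ u
        hang-v rewrite dec-true (v Fin.≟ v) refl = refl
        hang-≢ : ∀ {w} → w ≢ v → hang w ≡ w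
        hang-≢ {w} w≢v with w Fin.≟ v
        ... | yes eq = contradiction eq w≢v
        ... | no _   = refl
        constant′ : ConstantOn (S ∪ ⁅ elt j ⁆) (updateAt choice (elt j) (const (arc j))) (hang ∘ root)
        constant′ q q∈ with q Fin.≟ elt j
        ... | yes refl rewrite updateAt-updates (elt j) {const (arc j)} choice =
          trans (cong hang root-u) (trans (hang-≢ (proj₂ (proj₂ inH)))
            (sym (trans (cong hang root-v) hang-v)))
        ... | no q≢r rewrite updateAt-minimal q (elt j) {const (arc j)} choice q≢r =
          cong hang (constant q ([ id , ⊥-elim ∘ q≢r ]′ (x∈p∪⁅y⁆⁻ q∈)))
        -- Among the former roots only `v` changes its root, and its indegree is now positive.
        fixed′ : ∀ w → indeg (arc j ∷ A) w ≡ 0 → hang (root w) ≡ w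
        fixed′ w indeg≡0 with indeg-∷ A (arc j) w
        ... | inj₂ (eq , v≢w) =
          let root-w = fixed w (trans (sym eq) indeg≡0) in
          trans (cong hang root-w) (hang-≢ (v≢w ∘ sym))
        ... | inj₁ refl = contradiction indeg≡0 (indeg-head A (arc j))
          where
          indeg-head : ∀ A (a : Pair m) → indeg (a ∷ A) (proj₂ a) ≢ 0
          indeg-head A a with proj₂ a Fin.≟ proj₂ a
          ... | yes _ = λ ()
          ... | no ne = contradiction refl ne

    module _ (t : Fin n) (s≤t : s ≤ toℕ t) (r∈O : elt t ∈ opt t)
      (unblocked : ∀ j → s ≤ toℕ j → toℕ j < toℕ t → elt j ∈ opt j →
         proj₂ (arc j) ≢ proj₁ (arc t) × proj₂ (arc j) ≢ proj₂ (arc t)) where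

      HeadsArrived : ℕ → List (Pair m) → Set
      HeadsArrived i A = ∀ w → indeg A w ≢ 0 →
        ∃ λ j → toℕ j < i × s ≤ toℕ j × elt j ∈ opt j × proj₂ (arc j) ≡ w

      -- Until `t` is processed the invariant traces every head of an accepted arc to an arrival
      -- after the sample; from then on it only keeps `elt t` selected.
      SelectedAfter : ℕ → State H dec ord → Set
      SelectedAfter i ⟨ S , A ⟩ = (i ≤ toℕ t → HeadsArrived i A) × (toℕ t < i → elt t ∈ S)

      HeadsArrived-suc : ∀ {i} A → HeadsArrived i A → HeadsArrived (suc i) A
      HeadsArrived-suc A h w indeg≢0 =
        let j , j<i , rest = h w indeg≢0 in j , ℕ.m≤n⇒m≤1+n j<i , rest

      selectedAfter : SelectedAfter n (go 1 (toList π) ⟨ ∅ , [] ⟩)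
      selectedAfter = run-induction SelectedAfter
        ((λ _ _ 0≢0 → contradiction refl 0≢0) , λ ())
        accept reject
        where
        accept : ∀ j {S A} → SelectedAfter (toℕ j) ⟨ S , A ⟩ → Accepts j A →
          SelectedAfter (suc (toℕ j)) ⟨ S ∪ ⁅ elt j ⁆ , arc j ∷ A ⟩
        accept j {S} {A} (before , after) (s<1+j , r∈ , _) = before′ , after′
          where
          before′ : suc (toℕ j) ≤ toℕ t → HeadsArrived (suc (toℕ j)) (arc j ∷ A)
          before′ j<t w indeg≢0 with indeg-∷ A (arc j) w
          ... | inj₁ eq = j , ℕ.≤-refl , s≤s⁻¹ s<1+j , r∈ , eq
          ... | inj₂ (eq , _) =
            HeadsArrived-suc A (before (ℕ.<⇒≤ j<t)) w (indeg≢0 ∘ trans eq)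
          after′ : toℕ t < suc (toℕ j) → elt t ∈ S ∪ ⁅ elt j ⁆
          after′ t<1+j with t Fin.≟ j
          ... | yes refl = x∈p∪⁅x⁆ S (elt t)
          ... | no t≢j   = x∈p⇒x∈p∪⁅y⁆ (after (ℕ.≤∧≢⇒< (s≤s⁻¹ t<1+j) (t≢j ∘ Fin.toℕ-injective)))

        reject : ∀ j {S A} → SelectedAfter (toℕ j) ⟨ S , A ⟩ → ¬ Accepts j A →
          SelectedAfter (suc (toℕ j)) ⟨ S , A ⟩
        reject j {S} {A} (before , after) rej =
          (λ j<t → HeadsArrived-suc A (before (ℕ.<⇒≤ j<t))) , after′
          where
          free : (w : Fin m) → (∀ i → s ≤ toℕ i → toℕ i < toℕ j → elt i ∈ opt i → proj₂ (arc i) ≢ w) →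
            HeadsArrived (toℕ j) A → indeg A w ≡ 0
          free w none h = decidable-stable (_ ℕ.≟ 0) λ indeg≢0 →
            let i , i<j , s≤i , r∈ , eq = h w indeg≢0 in none i s≤i i<j r∈ eq
          after′ : toℕ t < suc (toℕ j) → elt t ∈ S
          after′ t<1+j with t Fin.≟ j
          ... | no t≢j   = after (ℕ.≤∧≢⇒< (s≤s⁻¹ t<1+j) (t≢j ∘ Fin.toℕ-injective))
          -- By `unblocked`, no accepted arc enters either end of `arc t`, so all acceptance
          -- conditions hold and `t` cannot be refused.
          ... | yes refl = contradiction
            (s≤s s≤t , r∈O
            , free _ (λ i s≤i i<t r∈ → proj₁ (unblocked i s≤i i<t r∈)) (before ℕ.≤-refl)
            , free _ (λ i s≤i i<t r∈ → proj₂ (unblocked i s≤i i<t r∈)) (before ℕ.≤-refl)) rej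

  forbidden : Subset n → Subset n → Fin n → Subset n
  forbidden X Y r* = withHead arcF (O X) (proj₁ (arcF (O Y) r*)) ∪
                     withHead arcF (O X) (proj₂ (arcF (O Y) r*))

  forbidden⊆ : ∀ X Y r* → forbidden X Y r* ⊆ X
  forbidden⊆ X Y r* x∈ = OPT⊆ X ([ head , head ]′ (x∈p∪q⁻ _ _ x∈))
    where
    head : ∀ {w x} → x ∈ withHead arcF (O X) w → x ∈ O X
    head {w} x∈ = proj₁ (∈-comprehension⁻ (hasHead? arcF (O X) w) x∈)

  ∣forbidden∣≤2 : ∀ X Y r* → ∣ forbidden X Y r* ∣ ≤ 2
  ∣forbidden∣≤2 X Y r* = ℕ.≤-trans
    (∣p∪q∣≤∣p∣+∣q∣ (withHead arcF (O X) (proj₁ (arcF (O Y) r*))) _)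
    (ℕ.+-mono-≤ (single (proj₁ (arcF (O Y) r*))) (single (proj₂ (arcF (O Y) r*))))
    where
    single : ∀ w → ∣ withHead arcF (O X) w ∣ ≤ 1
    single w = ℕ.≤-trans (ℕ.≤-reflexive (∣withHead∣≡indeg arcF (O X) w))
                         (proj₂ (validArcs (O X) (O-independent X)) w)

  hasForbiddenSets : HasForbiddenSets H dec ord arcF 2
  hasForbiddenSets =
    (λ π u s _ → let open Order π u s in _ , Rooted.valid rooted) ,
    (λ π u s _ t t<s t∈ → let open Order π u s
                              j , _ , s≤j , eq = Rooted.arrival rooted t∈ in
       ℕ.<⇒≱ t<s (ℕ.≤-trans s≤j (ℕ.≤-reflexive (cong toℕ (lookup-injective π u j t eq))))) ,
    forbidden ,
    (λ X Y r* _ _ _ → forbidden⊆ X Y r* , ∣forbidden∣≤2 X Y r*) ,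
    (λ π u s _ t s≤t r∈O clear → let open Order π u s in
       proj₂ (selectedAfter t s≤t r∈O λ j s≤j j<t r∈ →
         (λ eq → clear j s≤j j<t (p⊆p∪q _ (∈-comprehension⁺ (hasHead? arcF (opt j) _) (r∈ , eq)))) ,
         (λ eq → clear j s≤j j<t (q⊆p∪q _ _ (∈-comprehension⁺ (hasHead? arcF (opt j) _) (r∈ , eq)))))
         (Fin.toℕ<n t))

-- Sums

∑ : List A → (A → ℕ) → ℕ
∑ xs f = sum (map f xs)

∑-cong : {f g : A → ℕ} (xs : List A) → (∀ x → f x ≡ g x) → ∑ xs f ≡ ∑ xs g
∑-cong xs eq = cong sum (List.map-cong eq xs)

∑-mono : {f g : A → ℕ} (xs : List A) → (∀ x → x ∈ₗ xs → f x ≤ g x) → ∑ xs f ≤ ∑ xs g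
∑-mono []       le = z≤n
∑-mono (x ∷ xs) le = ℕ.+-mono-≤ (le x (Any.here refl)) (∑-mono xs λ y y∈ → le y (Any.there y∈))

∑-+ : (f g : A → ℕ) (xs : List A) → ∑ xs (λ x → f x + g x) ≡ ∑ xs f + ∑ xs g
∑-+ f g []       = refl
∑-+ f g (x ∷ xs) = trans (cong (f x + g x +_) (∑-+ f g xs))
  (interchange (f x) (g x) (∑ xs f) (∑ xs g))
  where
  interchange : ∀ a b c d → a + b + (c + d) ≡ a + c + (b + d)
  interchange = solve-∀

∑-*ˡ : (c : ℕ) (f : A → ℕ) (xs : List A) → ∑ xs (λ x → c * f x) ≡ c * ∑ xs f
∑-*ˡ c f []       = sym (ℕ.*-zeroʳ c)
∑-*ˡ c f (x ∷ xs) = trans (cong (c * f x +_) (∑-*ˡ c f xs)) (sym (ℕ.*-distribˡ-+ c (f x) (∑ xs f)))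

∑-zero : (xs : List A) → ∑ xs (λ _ → 0) ≡ 0
∑-zero []       = refl
∑-zero (_ ∷ xs) = ∑-zero xs

∑-swap : (f : A → B → ℕ) (xs : List A) (ys : List B) →
  ∑ xs (λ x → ∑ ys (f x)) ≡ ∑ ys (λ y → ∑ xs (λ x → f x y))
∑-swap f []       ys = sym (∑-zero ys)
∑-swap f (x ∷ xs) ys = trans (cong (∑ ys (f x) +_) (∑-swap f xs ys)) (sym (∑-+ (f x) _ ys))

∑-map : (f : B → ℕ) (g : A → B) (xs : List A) → ∑ (map g xs) f ≡ ∑ xs (f ∘ g)
∑-map f g xs = cong sum (sym (List.map-∘ xs))

∑-++ : (f : A → ℕ) (xs ys : List A) → ∑ (xs ++ ys) f ≡ ∑ xs f + ∑ ys f
∑-++ f xs ys = trans (cong sum (List.map-++ f xs ys)) (sum-++ (map f xs) (map f ys))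

∑-concatMap : (f : B → ℕ) (g : A → List B) (xs : List A) →
  ∑ (concatMap g xs) f ≡ ∑ xs (λ x → ∑ (g x) f)
∑-concatMap f g []       = refl
∑-concatMap f g (x ∷ xs) =
  trans (∑-++ f (g x) (concatMap g xs)) (cong (∑ (g x) f +_) (∑-concatMap f g xs))

∑-filter : {P : A → Set} (P? : ∀ x → Dec (P x)) (f : A → ℕ) (xs : List A) →
  ∑ (filter P? xs) f ≡ ∑ xs (λ x → if does (P? x) then f x else 0)
∑-filter P? f []       = refl
∑-filter P? f (x ∷ xs) with does (P? x)
... | true  = cong (f x +_) (∑-filter P? f xs)
... | false = ∑-filter P? f xs

length≡∑1 : (xs : List A) → length xs ≡ ∑ xs (λ _ → 1)
length≡∑1 []       = refl
length≡∑1 (_ ∷ xs) = cong suc (length≡∑1 xs)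

∑-allFin-suc : (f : Fin (suc n) → ℕ) → ∑ (allFin (suc n)) f ≡ f zero + ∑ (allFin n) (f ∘ suc)
∑-allFin-suc f = cong (λ l → f zero + sum l)
  (trans (List.map-tabulate suc f) (sym (List.map-tabulate id (f ∘ suc))))

∑-≥ : (Z : Subset n) (c : ℕ) (G : Fin n → ℕ) → (∀ {x} → x ∈ Z → c ≤ G x) →
  ∣ Z ∣ * c ≤ ∑ (allFin n) G
∑-≥ []            c G le = z≤n
∑-≥ (inside ∷ Z)  c G le rewrite ∑-allFin-suc G =
  ℕ.+-mono-≤ (le here) (∑-≥ Z c (G ∘ suc) (le ∘ there))
∑-≥ (outside ∷ Z) c G le rewrite ∑-allFin-suc G =
  ℕ.m≤n⇒m≤o+n (G zero) (∑-≥ Z c (G ∘ suc) (le ∘ there))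

-- Serves to split on the last arrival: `e` is the distinguished element, and `Z` holds the others,
-- which have a bound of their own.
∑-≥-with : (Z : Subset n) (a c : ℕ) (e : Fin n) (G : Fin n → ℕ) → e ∉ Z → a ≤ G e →
  (∀ {x} → x ∈ Z → c ≤ G x) → a + ∣ Z ∣ * c ≤ ∑ (allFin n) G
∑-≥-with (inside ∷ Z)  a c zero    G e∉ a≤ le = contradiction here e∉
∑-≥-with (outside ∷ Z) a c zero    G e∉ a≤ le rewrite ∑-allFin-suc G =
  ℕ.+-mono-≤ a≤ (∑-≥ Z c (G ∘ suc) (le ∘ there))
∑-≥-with (outside ∷ Z) a c (suc e) G e∉ a≤ le rewrite ∑-allFin-suc G =
  ℕ.m≤n⇒m≤o+n (G zero) (∑-≥-with Z a c e (G ∘ suc) (e∉ ∘ there) a≤ (le ∘ there))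
∑-≥-with (inside ∷ Z)  a c (suc e) G e∉ a≤ le rewrite ∑-allFin-suc G =
  ℕ.≤-trans (ℕ.≤-reflexive (rearrange a c (∣ Z ∣ * c)))
    (ℕ.+-mono-≤ (le here) (∑-≥-with Z a c e (G ∘ suc) (e∉ ∘ there) a≤ (le ∘ there)))
  where
  rearrange : ∀ a b c → a + (b + c) ≡ b + (a + c)
  rearrange = solve-∀

∑-≤ : (Z : Subset n) (c : ℕ) (G : Fin n → ℕ) → (∀ {x} → x ∈ Z → G x ≤ c) →
  (∀ {x} → x ∉ Z → G x ≡ 0) → ∑ (allFin n) G ≤ ∣ Z ∣ * c
∑-≤ []            c G le eq = z≤n
∑-≤ (inside ∷ Z)  c G le eq rewrite ∑-allFin-suc G =
  ℕ.+-mono-≤ (le here) (∑-≤ Z c (G ∘ suc) (le ∘ there) (λ x∉ → eq (x∉ ∘ drop-there)))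
∑-≤ (outside ∷ Z) c G le eq rewrite ∑-allFin-suc G | eq {zero} (λ ()) =
  ∑-≤ Z c (G ∘ suc) (le ∘ there) (λ x∉ → eq (x∉ ∘ drop-there))

-- Counting permutations

∑-allVecs-∷ : (f : Vec (Fin n) (suc ℓ) → ℕ) →
  ∑ (allVecs n (suc ℓ)) f ≡ ∑ (allFin n) (λ x → ∑ (allVecs n ℓ) (λ v → f (x ∷ v)))
∑-allVecs-∷ {n} {k} f = trans (∑-concatMap f _ (allFin n))
  (∑-cong (allFin n) λ x → ∑-map f (x ∷_) (allVecs n k))

-- `allVecs` branches on the first entry; exchanging the sums over first and last entries lets the
-- last one be chosen first.
∑-allVecs-∷ʳ : (f : Vec (Fin n) (suc ℓ) → ℕ) →
  ∑ (allVecs n (suc ℓ)) f ≡ ∑ (allFin n) (λ x → ∑ (allVecs n ℓ) (λ v → f (v Vec.∷ʳ x)))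
∑-allVecs-∷ʳ {n} {zero}  f = ∑-allVecs-∷ f
∑-allVecs-∷ʳ {n} {suc k} f = begin
  ∑ (allVecs n (suc (suc k))) f
    ≡⟨ ∑-allVecs-∷ f ⟩
  ∑ (allFin n) (λ x → ∑ (allVecs n (suc k)) (λ w → f (x ∷ w)))
    ≡⟨ ∑-cong (allFin n) (λ x → ∑-allVecs-∷ʳ (λ w → f (x ∷ w))) ⟩
  ∑ (allFin n) (λ x → ∑ (allFin n) (λ y → ∑ (allVecs n k) (λ v → f (x ∷ (v Vec.∷ʳ y)))))
    ≡⟨ ∑-swap _ (allFin n) (allFin n) ⟩
  ∑ (allFin n) (λ y → ∑ (allFin n) (λ x → ∑ (allVecs n k) (λ v → f (x ∷ (v Vec.∷ʳ y)))))
    ≡⟨ ∑-cong (allFin n) (λ y → sym (∑-allVecs-∷ (λ w → f (w Vec.∷ʳ y)))) ⟩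
  ∑ (allFin n) (λ y → ∑ (allVecs n (suc k)) (λ w → f (w Vec.∷ʳ y))) ∎
  where open ≡-Reasoning

-- A first entry `x` in `X` leaves repetition-free vectors over `X - x`, and one outside `X`
-- contributes nothing. For general `f` the fixed entry can be absorbed into the function.
vectors-≤ : ∀ k (X : Subset n) → ∣ X ∣ ≡ k → (f : Vec (Fin n) k → ℕ) → (∀ v → f v ≤ 1) →
  (∀ v → ¬ (Unique (toList v) × (∀ {x} → x ∈ₗ toList v → x ∈ X)) → f v ≡ 0) →
  ∑ (allVecs n k) f ≤ k !
vectors-≤ zero    X ∣X∣≡0 f f≤1 f≡0 = ℕ.≤-trans (ℕ.≤-reflexive (ℕ.+-identityʳ _)) (f≤1 [])
vectors-≤ {n} (suc k) X ∣X∣≡ f f≤1 f≡0 = begin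
  ∑ (allVecs n (suc k)) f                                         ≡⟨ ∑-allVecs-∷ f ⟩
  ∑ (allFin n) (λ x → ∑ (allVecs n k) (λ v → f (x ∷ v)))          ≤⟨ ∑-≤ X (k !) _ inX notInX ⟩
  ∣ X ∣ * k !                                                     ≡⟨ cong (_* k !) ∣X∣≡ ⟩
  suc k !                                                         ∎
  where
  open ℕ.≤-Reasoning
  inX : ∀ {x} → x ∈ X → ∑ (allVecs n k) (λ v → f (x ∷ v)) ≤ k !
  inX {x} x∈X = vectors-≤ k (X - x) (ℕ.suc-injective (trans (suc∣p-x∣≡∣p∣ x∈X) ∣X∣≡)) _
    (λ v → f≤1 (x ∷ v))
    (λ v bad → f≡0 (x ∷ v) λ { (u@(x≢ AllPairs.∷ uv) , v⊆X) → bad (uv ,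
       λ y∈ → x∈p∧x≢y⇒x∈p-y (v⊆X (Any.there y∈)) (All.lookup x≢ y∈ ∘ sym)) })
  notInX : ∀ {x} → x ∉ X → ∑ (allVecs n k) (λ v → f (x ∷ v)) ≡ 0
  notInX {x} x∉X = trans
    (∑-cong (allVecs n k) λ v → f≡0 (x ∷ v) λ (_ , ⊆X) → x∉X (⊆X (Any.here refl)))
    (∑-zero (allVecs n k))

-- An upper bound is the right direction, as the number of orders stands on the smaller side of the
-- competitive inequality.
∣perms∣≤n! : ∀ n → length (perms n) ≤ n !
∣perms∣≤n! n = begin
  length (perms n)
    ≡⟨ length≡∑1 (perms n) ⟩
  ∑ (perms n) (λ _ → 1)
    ≡⟨ ∑-filter (λ v → DU.unique? Fin._≟_ (toList v)) _ (allVecs n n) ⟩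
  ∑ (allVecs n n) (λ v → if does (DU.unique? Fin._≟_ (toList v)) then 1 else 0)
    ≤⟨ vectors-≤ n full (∣⊤∣≡n n) _ ≤1 ≡0 ⟩
  n ! ∎
  where
  open ℕ.≤-Reasoning
  ≤1 : ∀ (v : Vec (Fin n) n) → (if does (DU.unique? Fin._≟_ (toList v)) then 1 else 0) ≤ 1
  ≤1 v with does (DU.unique? Fin._≟_ (toList v))
  ... | true  = ℕ.≤-refl
  ... | false = z≤n
  ≡0 : ∀ (v : Vec (Fin n) n) → ¬ (Unique (toList v) × (∀ {x} → x ∈ₗ toList v → x ∈ full)) →
    (if does (DU.unique? Fin._≟_ (toList v)) then 1 else 0) ≡ 0
  ≡0 v bad rewrite dec-false (DU.unique? Fin._≟_ (toList v)) (λ u → bad (u , λ _ → ∈⊤)) = refl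

-- Phrased with `setOf`, the fold behind `prefixSet`, so that prefixes of an order enumerate the
-- sets on which the algorithm computes its optimum.
record Enumerates (X : Subset n) (l : List (Fin n)) : Set where
  constructor enumerates
  field
    unique : Unique l
    setOf≡ : setOf l ≡ X

Enumerates-∷ʳ : {X : Subset n} {x : Fin n} {l : List (Fin n)} → x ∈ X → Enumerates (X - x) l →
  Enumerates X (l ∷ʳ x)
Enumerates-∷ʳ {X = X} {x} {l} x∈X (enumerates u eq) = enumerates
  (Unique.++⁺ u (All.[] AllPairs.∷ AllPairs.[]) λ { (y∈l , Any.here refl) →
     x∉p-x X x (subst (x ∈_) eq (∈-setOf⁺ y∈l)) })
  (⊆-antisym
    (λ y∈ → [ (λ y∈l → p-x⊆p X x (subst (_ ∈_) eq (∈-setOf⁺ y∈l))) , (λ { (Any.here refl) → x∈X }) ]′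
              (∈-++⁻ l (∈-setOf⁻ (l ∷ʳ x) y∈)))
    back)
  where
  back : X ⊆ setOf (l ∷ʳ x)
  back {y} y∈X with y Fin.≟ x
  ... | yes refl = ∈-setOf⁺ (∈-++⁺ʳ l (Any.here refl))
  ... | no y≢x   = ∈-setOf⁺ (∈-++⁺ˡ (∈-setOf⁻ l (subst (y ∈_) (sym eq) (x∈p∧x≢y⇒x∈p-y y∈X y≢x))))

∣X-x∣ : {X : Subset n} {x : Fin n} → x ∈ X → ∣ X ∣ ≡ suc ℓ → ∣ X - x ∣ ≡ ℓ
∣X-x∣ x∈X ∣X∣≡ = ℕ.suc-injective (trans (suc∣p-x∣≡∣p∣ x∈X) ∣X∣≡)

-- A property of the prefixes of an enumeration is counted by choosing the last element first:
-- the prefix enumerates what remains.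
module _ {X : Subset n} {P : List (Fin n) → Set} {f : Vec (Fin n) (suc ℓ) → ℕ}
  (f≥1 : ∀ v → Enumerates X (toList v) → P (toList v) → 1 ≤ f v) where

  ∷ʳ-≥1 : ∀ {x} → x ∈ X → (v : Vec (Fin n) ℓ) → Enumerates (X - x) (toList v) →
    P (toList v ∷ʳ x) → 1 ≤ f (v Vec.∷ʳ x)
  ∷ʳ-≥1 {x} x∈X v en p = f≥1 (v Vec.∷ʳ x)
    (subst (Enumerates X) (sym (Vec.toList-∷ʳ x v)) (Enumerates-∷ʳ x∈X en))
    (subst P (sym (Vec.toList-∷ʳ x v)) p)

enumerations-≥ : ∀ k (X : Subset n) → ∣ X ∣ ≡ k → (f : Vec (Fin n) k → ℕ) →
  (∀ v → Enumerates X (toList v) → 1 ≤ f v) → k ! ≤ ∑ (allVecs n k) f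
enumerations-≥ {n} zero X ∣X∣≡0 f f≥1 = ℕ.≤-trans
  (f≥1 [] (enumerates AllPairs.[] (sym (Empty-unique λ (x , x∈) →
    contradiction (trans (suc∣p-x∣≡∣p∣ x∈) ∣X∣≡0) λ ()))))
  (ℕ.m≤m+n _ 0)
enumerations-≥ {n} (suc k) X ∣X∣≡ f f≥1 = begin
  suc k * k !   ≡⟨ cong (_* k !) (sym ∣X∣≡) ⟩
  ∣ X ∣ * k !   ≤⟨ ∑-≥ X (k !) _ (λ {x} x∈X → enumerations-≥ k (X - x) (∣X-x∣ x∈X ∣X∣≡) _
                     λ v en → ∷ʳ-≥1 {P = λ _ → Unit} (λ v en _ → f≥1 v en) x∈X v en _) ⟩
  ∑ (allFin n) (λ x → ∑ (allVecs n k) (λ v → f (v Vec.∷ʳ x))) ≡⟨ sym (∑-allVecs-∷ʳ f) ⟩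
  ∑ (allVecs n (suc k)) f ∎
  where
  open ℕ.≤-Reasoning

-- Lower bounds on the number of good orders

∣p∣≤∣p─q∣+∣q∣ : (p q : Subset n) → ∣ p ∣ ≤ ∣ p ─ q ∣ + ∣ q ∣
∣p∣≤∣p─q∣+∣q∣ p q = ℕ.≤-trans (p⊆q⇒∣p∣≤∣q∣ cover) (∣p∪q∣≤∣p∣+∣q∣ (p ─ q) q)
  where
  cover : p ⊆ (p ─ q) ∪ q
  cover {x} x∈p with x ∈? q
  ... | yes x∈q = q⊆p∪q _ _ x∈q
  ... | no x∉q  = p⊆p∪q _ (x∈p∧x∉q⇒x∈p─q x∈p x∉q)

x∈p─q⇒x∉q : (p q : Subset n) {x : Fin n} → x ∈ p ─ q → x ∉ q
x∈p─q⇒x∉q (_ ∷ p) (outside ∷ q) here       ()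
x∈p─q⇒x∉q (_ ∷ p) (inside ∷ q)  ()         here
x∈p─q⇒x∉q (_ ∷ p) (_ ∷ q)       (there x∈) (there x∈q) = x∈p─q⇒x∉q p q x∈ x∈q

-- clearCount s d bounds from below the number of orders of d + s elements in which none of the last d
-- arrivals is forbidden, goodCount s d the number of orders of d + s elements in which the
-- distinguished one arrives among the last d and no forbidden arrival precedes it after time s.
clearCount : ℕ → ℕ → ℕ
clearCount s zero    = s !
clearCount s (suc d) = (d + s ∸ 1) * clearCount s d

goodCount : ℕ → ℕ → ℕ
goodCount s zero    = 0
goodCount s (suc d) = clearCount s d + (d + s) * goodCount s d

module Counting (F : Subset n → Subset n → Subset n) (e : Fin n)
  (F≤2 : ∀ X Y → e ∈ Y → X ⊆ Y → e ∉ X → ∣ F X Y ∣ ≤ 2) (s : ℕ) where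

  -- Positions are splittings of the list rather than indices, which makes appending a last arrival
  -- easy to analyse. Here `p ∷ʳ x` is the prefix ending with the arrival of `x`.
  Clear : Subset n → List (Fin n) → Set
  Clear Y l = ∀ p x q → l ≡ p ++ x ∷ q → s ≤ length p → x ∉ F (setOf (p ∷ʳ x)) Y

  Good : List (Fin n) → Set
  Good l = ∃₂ λ p q → l ≡ p ++ e ∷ q × s ≤ length p × Clear (setOf (p ∷ʳ e)) p

  Clear-∷ʳ : ∀ {X Y x l} → Enumerates X (l ∷ʳ x) → x ∉ F X Y → Clear Y l → Clear Y (l ∷ʳ x)
  Clear-∷ʳ {X} {Y} {x} {l} (enumerates _ refl) x∉F clear p y q eq s≤ with initLast q
  ... | [] with List.∷ʳ-injective l p eq
  ...   | refl , refl = x∉F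
  Clear-∷ʳ {X} {Y} {x} {l} _ _ clear p y q eq s≤ | q′ ∷ʳ′ z = clear p y q′
    (List.∷ʳ-injectiveˡ l (p ++ y ∷ q′) (trans eq (sym (List.++-assoc p (y ∷ q′) [ z ])))) s≤

  -- The set `F X Y` depends on the set `X` of arrivals but not on their order, so it is known
  -- before the last arrival is chosen. At most two choices are excluded, and the rest of the order
  -- enumerates a smaller set.
  clear-≥ : ∀ {Y} → e ∈ Y → ∀ d X → ∣ X ∣ ≡ d + s → X ⊆ Y → e ∉ X →
    (f : Vec (Fin n) (d + s) → ℕ) →
    (∀ v → Enumerates X (toList v) → Clear Y (toList v) → 1 ≤ f v) →
    clearCount s d ≤ ∑ (allVecs n (d + s)) f
  -- In a list of length `s` no element has `s` predecessors, so `Clear` holds vacuously.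
  clear-≥ {Y} e∈Y zero X ∣X∣≡ X⊆Y e∉X f f≥1 = enumerations-≥ s X ∣X∣≡ f
    λ v en → f≥1 v en λ p x q eq s≤ → contradiction s≤ (ℕ.<⇒≱ (ℕ.≤-trans
      (ℕ.≤-trans (ℕ.m<m+n (length p) (s≤s z≤n)) (ℕ.≤-reflexive (sym (List.length-++ p))))
      (ℕ.≤-reflexive (trans (cong length (sym eq)) (Vec.length-toList v)))))
  clear-≥ {Y} e∈Y (suc d) X ∣X∣≡ X⊆Y e∉X f f≥1 = begin
    (d + s ∸ 1) * clearCount s d
      ≤⟨ ℕ.*-monoˡ-≤ (clearCount s d) (ℕ.m≤n+o⇒m∸n≤o (suc (d + s)) 2 size) ⟩
    ∣ X ─ F X Y ∣ * clearCount s d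
      ≤⟨ ∑-≥ (X ─ F X Y) (clearCount s d) _ last ⟩
    ∑ (allFin n) (λ x → ∑ (allVecs n (d + s)) (λ v → f (v Vec.∷ʳ x)))
      ≡⟨ sym (∑-allVecs-∷ʳ f) ⟩
    ∑ (allVecs n (suc (d + s))) f ∎
    where
    open ℕ.≤-Reasoning
    size : suc (d + s) ≤ 2 + ∣ X ─ F X Y ∣
    size = begin
      suc (d + s)                     ≡⟨ sym ∣X∣≡ ⟩
      ∣ X ∣                           ≤⟨ ∣p∣≤∣p─q∣+∣q∣ X (F X Y) ⟩
      ∣ X ─ F X Y ∣ + ∣ F X Y ∣       ≤⟨ ℕ.+-monoʳ-≤ _ (F≤2 X Y e∈Y X⊆Y e∉X) ⟩
      ∣ X ─ F X Y ∣ + 2               ≡⟨ ℕ.+-comm _ 2 ⟩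
      2 + ∣ X ─ F X Y ∣               ∎
    last : ∀ {x} → x ∈ X ─ F X Y → clearCount s d ≤ ∑ (allVecs n (d + s)) (λ v → f (v Vec.∷ʳ x))
    last {x} x∈ = clear-≥ e∈Y d (X - x) (∣X-x∣ x∈X ∣X∣≡) (X⊆Y ∘ p-x⊆p X x) (e∉X ∘ p-x⊆p X x) _
      λ v en clear → ∷ʳ-≥1 {P = Clear Y} f≥1 x∈X v en
        (Clear-∷ʳ (Enumerates-∷ʳ x∈X en) (x∈p─q⇒x∉q X (F X Y) x∈) clear)
      where
      x∈X = p─q⊆p X (F X Y) x∈

  -- If `e` arrives last, the earlier arrivals must be clear with respect to `Y`; if another element
  -- does, it imposes no condition and the earlier arrivals must already form a good order.
  good-≥ : ∀ d Y → ∣ Y ∣ ≡ d + s → e ∈ Y → (f : Vec (Fin n) (d + s) → ℕ) →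
    (∀ v → Enumerates Y (toList v) → Good (toList v) → 1 ≤ f v) →
    goodCount s d ≤ ∑ (allVecs n (d + s)) f
  good-≥ zero    Y ∣Y∣≡ e∈Y f f≥1 = z≤n
  good-≥ (suc d) Y ∣Y∣≡ e∈Y f f≥1 = begin
    clearCount s d + (d + s) * goodCount s d
      ≡⟨ cong (λ z → clearCount s d + z * goodCount s d) (sym (∣X-x∣ e∈Y ∣Y∣≡)) ⟩
    clearCount s d + ∣ Y - e ∣ * goodCount s d
      ≤⟨ ∑-≥-with (Y - e) (clearCount s d) (goodCount s d) e _ (x∉p-x Y e) e-last x-last ⟩
    ∑ (allFin n) (λ x → ∑ (allVecs n (d + s)) (λ v → f (v Vec.∷ʳ x)))
      ≡⟨ sym (∑-allVecs-∷ʳ f) ⟩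
    ∑ (allVecs n (suc (d + s))) f ∎
    where
    open ℕ.≤-Reasoning
    e-last : clearCount s d ≤ ∑ (allVecs n (d + s)) (λ v → f (v Vec.∷ʳ e))
    e-last = clear-≥ e∈Y d (Y - e) (∣X-x∣ e∈Y ∣Y∣≡) (p-x⊆p Y e) (x∉p-x Y e) _
      λ v en clear → ∷ʳ-≥1 {P = Good} f≥1 e∈Y v en
        (toList v , [] , refl
        , ℕ.≤-trans (ℕ.m≤n+m s d) (ℕ.≤-reflexive (sym (Vec.length-toList v)))
        , subst (λ Z → Clear Z (toList v)) (sym (Enumerates.setOf≡ (Enumerates-∷ʳ e∈Y en))) clear)
    x-last : ∀ {x} → x ∈ Y - e → goodCount s d ≤ ∑ (allVecs n (d + s)) (λ v → f (v Vec.∷ʳ x))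
    x-last {x} x∈ = good-≥ d (Y - x) (∣X-x∣ x∈Y ∣Y∣≡)
      (x∈p∧x≢y⇒x∈p-y e∈Y λ { refl → x∉p-x Y e x∈ }) _
      λ v en (p , q , eq , rest) → ∷ʳ-≥1 {P = Good} f≥1 x∈Y v en
        (p , q ∷ʳ x , trans (cong (_∷ʳ x) eq) (List.++-assoc p (e ∷ q) [ x ]) , rest)
      where
      x∈Y = p-x⊆p Y e x∈

-- Indices of a vector as splittings of its list

splitAtIndex : (v : Vec A ℓ) (j : Fin ℓ) → ∃₂ λ p q → toList v ≡ p ++ lookup v j ∷ q ×
  length p ≡ toℕ j × take (suc (toℕ j)) (toList v) ≡ p ∷ʳ lookup v j
splitAtIndex (x ∷ v) zero    = [] , toList v , refl , refl , refl
splitAtIndex (x ∷ v) (suc j) = let p , q , eq , len , eq′ = splitAtIndex v j in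
  x ∷ p , q , cong (x ∷_) eq , cong suc len , cong (x ∷_) eq′

indexAtSplit : (v : Vec A ℓ) (p : List A) {x : A} {q : List A} → toList v ≡ p ++ x ∷ q →
  ∃ λ t → toℕ t ≡ length p × lookup v t ≡ x × take (suc (toℕ t)) (toList v) ≡ p ∷ʳ x
indexAtSplit (x ∷ v) []      refl = zero , refl , refl , refl
indexAtSplit (x ∷ v) (y ∷ p) eq with List.∷-injective eq
... | refl , eq′ = let t , len , look , tk = indexAtSplit v p eq′ in
  suc t , cong suc len , look , cong (x ∷_) tk

++-prefix : (p l : List A) {x y : A} {q r : List A} → p ++ x ∷ q ≡ l ++ y ∷ r →
  length p < length l → ∃ λ q′ → l ≡ p ++ x ∷ q′
++-prefix []      (z ∷ l) eq lt = l , cong (_∷ l) (sym (List.∷-injectiveˡ eq))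
++-prefix (w ∷ p) (z ∷ l) eq (s≤s lt) with List.∷-injective eq
... | refl , eq′ = let q′ , eq″ = ++-prefix p l eq′ lt in q′ , cong (w ∷_) eq″

-- Binomial arithmetic

*-swap : ∀ a b c → a * (b * c) ≡ b * (a * c)
*-swap = solve-∀

binomialSum : ℕ → (ℕ → ℕ) → ℕ
binomialSum n ψ = ∑ (upTo (suc n)) (λ s → (n C s) * ψ s)

∑-upTo-suc : ∀ n (f : ℕ → ℕ) → ∑ (upTo (suc n)) f ≡ f 0 + ∑ (upTo n) (f ∘ suc)
∑-upTo-suc n f = cong (λ l → f 0 + sum l)
  (trans (List.map-applyUpTo suc f n) (sym (List.map-upTo (f ∘ suc) n)))

∑-upTo-last : ∀ n (f : ℕ → ℕ) → ∑ (upTo (suc n)) f ≡ ∑ (upTo n) f + f n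
∑-upTo-last n f = trans (cong (λ l → ∑ l f) (sym (List.upTo-∷ʳ n)))
  (trans (∑-++ f (upTo n) [ n ]) (cong (∑ (upTo n) f +_) (ℕ.+-identityʳ (f n))))

∑-upTo-cong : ∀ n {f g : ℕ → ℕ} → (∀ s → s < n → f s ≡ g s) → ∑ (upTo n) f ≡ ∑ (upTo n) g
∑-upTo-cong n eq = ℕ.≤-antisym
  (∑-mono (upTo n) λ s s∈ → ℕ.≤-reflexive (eq s (∈-upTo⁻ s∈)))
  (∑-mono (upTo n) λ s s∈ → ℕ.≤-reflexive (sym (eq s (∈-upTo⁻ s∈))))

-- Pascal's rule splits each coefficient, and the boundary term with `n C suc n` vanishes.
binomialSum-suc : ∀ n ψ → binomialSum (suc n) ψ ≡ binomialSum n (λ s → ψ s + ψ (suc s))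
binomialSum-suc n ψ = begin
  ∑ (upTo (suc (suc n))) (λ s → (suc n C s) * ψ s)
    ≡⟨ ∑-upTo-suc (suc n) (λ s → (suc n C s) * ψ s) ⟩
  (n C 0) * ψ 0 + ∑ (upTo (suc n)) (λ s → (suc n C suc s) * ψ (suc s))
    ≡⟨ cong ((n C 0) * ψ 0 +_) (∑-cong (upTo (suc n)) λ s →
         trans (cong (_* ψ (suc s)) (sym (nCk+nC[k+1]≡[n+1]C[k+1] n s)))
               (ℕ.*-distribʳ-+ (ψ (suc s)) (n C s) (n C suc s))) ⟩
  (n C 0) * ψ 0 + ∑ (upTo (suc n)) (λ s → (n C s) * ψ (suc s) + (n C suc s) * ψ (suc s))
    ≡⟨ cong ((n C 0) * ψ 0 +_) (∑-+ (λ s → (n C s) * ψ (suc s)) _ (upTo (suc n))) ⟩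
  (n C 0) * ψ 0 + (U + ∑ (upTo (suc n)) (λ s → (n C suc s) * ψ (suc s)))
    ≡⟨ rearrange ((n C 0) * ψ 0) U _ ⟩
  (n C 0) * ψ 0 + ∑ (upTo (suc n)) (λ s → (n C suc s) * ψ (suc s)) + U
    ≡⟨ cong (_+ U) (sym (∑-upTo-suc (suc n) (λ s → (n C s) * ψ s))) ⟩
  ∑ (upTo (suc (suc n))) (λ s → (n C s) * ψ s) + U
    ≡⟨ cong (_+ U) (∑-upTo-last (suc n) (λ s → (n C s) * ψ s)) ⟩
  binomialSum n ψ + (n C suc n) * ψ (suc n) + U
    ≡⟨ cong (λ c → binomialSum n ψ + c * ψ (suc n) + U) (k>n⇒nCk≡0 (ℕ.n<1+n n)) ⟩
  binomialSum n ψ + 0 + U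
    ≡⟨ cong (_+ U) (ℕ.+-identityʳ (binomialSum n ψ)) ⟩
  binomialSum n ψ + U
    ≡⟨ sym (∑-+ (λ s → (n C s) * ψ s) _ (upTo (suc n))) ⟩
  ∑ (upTo (suc n)) (λ s → (n C s) * ψ s + (n C s) * ψ (suc s))
    ≡⟨ ∑-cong (upTo (suc n)) (λ s → sym (ℕ.*-distribˡ-+ (n C s) (ψ s) (ψ (suc s)))) ⟩
  binomialSum n (λ s → ψ s + ψ (suc s)) ∎
  where
  open ≡-Reasoning
  U = ∑ (upTo (suc n)) (λ s → (n C s) * ψ (suc s))
  rearrange : ∀ a b c → a + (b + c) ≡ a + c + b
  rearrange = solve-∀

binomialSum-cong : ∀ n {ψ φ} → (∀ s → s ≤ n → ψ s ≡ φ s) → binomialSum n ψ ≡ binomialSum n φ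
binomialSum-cong n eq = ∑-upTo-cong (suc n) λ s s<1+n → cong ((n C s) *_) (eq s (s≤s⁻¹ s<1+n))

binomialSum-+ : ∀ n ψ φ → binomialSum n (λ s → ψ s + φ s) ≡ binomialSum n ψ + binomialSum n φ
binomialSum-+ n ψ φ = trans
  (∑-cong (upTo (suc n)) λ s → ℕ.*-distribˡ-+ (n C s) (ψ s) (φ s))
  (∑-+ (λ s → (n C s) * ψ s) _ (upTo (suc n)))

binomialSum-*ˡ : ∀ n c ψ → binomialSum n (λ s → c * ψ s) ≡ c * binomialSum n ψ
binomialSum-*ˡ n c ψ = trans
  (∑-cong (upTo (suc n)) λ s → *-swap (n C s) c (ψ s)) (∑-*ˡ c _ (upTo (suc n)))

binomialSum-const : ∀ n c → binomialSum n (λ _ → c) ≡ 2 ^ n * c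
binomialSum-const zero    c = ℕ.+-identityʳ _
binomialSum-const (suc n) c = trans (binomialSum-suc n (λ _ → c))
  (trans (binomialSum-const n (c + c)) (double (2 ^ n) c))
  where
  double : ∀ a c → a * (c + c) ≡ 2 * a * c
  double = solve-∀

-- The factor 4 avoids the exponent `n ∸ 2`. After Pascal's rule the induction rests on s (n + 1 -
-- s) + (s + 1) (n - s) = 2 s (n - s) + n.
4∑Cs[n∸s] : ∀ n → 4 * binomialSum n (λ s → s * (n ∸ s)) ≡ n * (n ∸ 1) * 2 ^ n
4∑Cs[n∸s] zero    = refl
4∑Cs[n∸s] (suc n) = begin
  4 * binomialSum (suc n) (λ s → s * (suc n ∸ s))
    ≡⟨ cong (4 *_) (binomialSum-suc n (λ s → s * (suc n ∸ s))) ⟩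
  4 * binomialSum n (λ s → s * (suc n ∸ s) + suc s * (n ∸ s))
    ≡⟨ cong (4 *_) (binomialSum-cong n split) ⟩
  4 * binomialSum n (λ s → 2 * (s * (n ∸ s)) + n)
    ≡⟨ cong (4 *_) (trans (binomialSum-+ n (λ s → 2 * (s * (n ∸ s))) _)
         (cong₂ _+_ (binomialSum-*ˡ n 2 (λ s → s * (n ∸ s))) (binomialSum-const n n))) ⟩
  4 * (2 * binomialSum n (λ s → s * (n ∸ s)) + 2 ^ n * n)
    ≡⟨ expand (binomialSum n (λ s → s * (n ∸ s))) (2 ^ n) n ⟩
  2 * (4 * binomialSum n (λ s → s * (n ∸ s))) + 4 * 2 ^ n * n
    ≡⟨ cong (λ z → 2 * z + 4 * 2 ^ n * n) (4∑Cs[n∸s] n) ⟩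
  2 * (n * (n ∸ 1) * 2 ^ n) + 4 * 2 ^ n * n
    ≡⟨ collect n ⟩
  suc n * n * (2 * 2 ^ n) ∎
  where
  open ≡-Reasoning
  expand : ∀ b p n → 4 * (2 * b + p * n) ≡ 2 * (4 * b) + 4 * p * n
  expand = solve-∀
  collect′ : ∀ n p → 2 * (suc n * n * p) + 4 * p * suc n ≡ suc (suc n) * suc n * (2 * p)
  collect′ = solve-∀
  collect : ∀ n → 2 * (n * (n ∸ 1) * 2 ^ n) + 4 * 2 ^ n * n ≡ suc n * n * (2 * 2 ^ n)
  collect zero    = refl
  collect (suc n) = collect′ n (2 ^ suc n)
  identity : ∀ s d → s * suc d + suc s * d ≡ 2 * (s * d) + (s + d)
  identity = solve-∀
  split : ∀ s → s ≤ n → s * (suc n ∸ s) + suc s * (n ∸ s) ≡ 2 * (s * (n ∸ s)) + n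
  split s s≤n rewrite ℕ.+-∸-assoc 1 s≤n =
    trans (identity s (n ∸ s)) (cong (2 * (s * (n ∸ s)) +_) (ℕ.m+[n∸m]≡n s≤n))

-- The telescoping product of the factors (j - 2) / j, with denominators cleared.
clearCount-closed : ∀ s d →
  clearCount s d * ((d + s) * (d + s ∸ 1)) ≡ (d + s) ! * (s * (s ∸ 1))
clearCount-closed s zero    = refl
clearCount-closed s (suc d) = trans (step (d + s) (d + s ∸ 1) (clearCount s d))
  (trans (cong (suc (d + s) *_) (clearCount-closed s d))
         (sym (ℕ.*-assoc (suc (d + s)) ((d + s) !) (s * (s ∸ 1)))))
  where
  step : ∀ k k′ h → k′ * h * (suc k * k) ≡ suc k * (h * (k * k′))
  step = solve-∀

-- The selection bound for a fixed sample size, with denominators cleared. The sample has size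
-- `suc s` because the formula fails for an empty one: `goodCount 0 2` is 1.
goodCount-closed : ∀ s d →
  goodCount (suc s) d * ((d + suc s) * (d + suc s ∸ 1)) ≡ (d + suc s) ! * (suc s * d)
goodCount-closed s zero = sym (trans (cong (suc s ! *_) (ℕ.*-zeroʳ (suc s))) (ℕ.*-zeroʳ (suc s !)))
goodCount-closed s (suc d) = step d s (clearCount-closed (suc s) d) (goodCount-closed s d)
  where
  factor : ∀ k j h g → (h + k * g) * (suc k * k) * j ≡
    suc k * (h * (k * j)) + suc k * k * (g * (k * j))
  factor = solve-∀
  combine : ∀ d s f → suc (suc (d + s)) * (f * (suc s * s)) +
    suc (suc (d + s)) * suc (d + s) * (f * (suc s * d)) ≡
    suc (suc (d + s)) * f * (suc s * suc d) * (d + s)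
  combine = solve-∀
  -- The hypotheses carry `k * (k ∸ 1)` and the goal `suc k * k`; multiplying the goal by `k ∸ 1`,
  -- which is `d + s`, lets them apply.
  cancel : ∀ d s {k} h g f → .{{NonZero (d + s)}} → k ≡ suc (d + s) →
    h * (k * (k ∸ 1)) ≡ f * (suc s * s) → g * (k * (k ∸ 1)) ≡ f * (suc s * d) →
    (h + k * g) * (suc k * k) ≡ suc k * f * (suc s * suc d)
  cancel d s h g f refl eq-h eq-g = ℕ.*-cancelʳ-≡ _ _ (d + s) (trans
    (factor (suc (d + s)) (d + s) h g)
    (trans (cong₂ (λ a b → suc (suc (d + s)) * a + suc (suc (d + s)) * suc (d + s) * b) eq-h eq-g)
           (combine d s f)))
  step : ∀ d s →
    clearCount (suc s) d * ((d + suc s) * (d + suc s ∸ 1)) ≡ (d + suc s) ! * (suc s * s) →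
    goodCount (suc s) d * ((d + suc s) * (d + suc s ∸ 1)) ≡ (d + suc s) ! * (suc s * d) →
    goodCount (suc s) (suc d) * ((suc d + suc s) * (suc d + suc s ∸ 1)) ≡
      (suc d + suc s) ! * (suc s * suc d)
  -- Here `d + s` is 0 and cannot be cancelled, but both sides compute.
  step zero    zero    _    _    = refl
  step zero    (suc s) eq-h eq-g =
    cancel 0 (suc s) (clearCount (suc (suc s)) 0) 0 (suc (suc s) !) refl eq-h eq-g
  step (suc d) s       eq-h eq-g =
    cancel (suc d) s (clearCount (suc s) (suc d)) (goodCount (suc s) (suc d))
      ((suc d + suc s) !) (ℕ.+-suc (suc d) s) eq-h eq-g

goodCount-≥ : ∀ n s → s ≤ n → n ! * (s * (n ∸ s)) ≤ goodCount s (n ∸ s) * (n * (n ∸ 1))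
goodCount-≥ n zero    _   = ℕ.≤-trans (ℕ.≤-reflexive (ℕ.*-zeroʳ (n !))) z≤n
goodCount-≥ n (suc s) s<n = ℕ.≤-reflexive (subst
  (λ k → k ! * (suc s * (n ∸ suc s)) ≡ goodCount (suc s) (n ∸ suc s) * (k * (k ∸ 1)))
  (ℕ.m∸n+n≡m s<n) (sym (goodCount-closed s (n ∸ suc s))))

n!2^n≤4∑goodCount : ∀ n → n ≢ 0 →
  n ! * 2 ^ n ≤ 4 * binomialSum n (λ s → goodCount s (n ∸ s))
n!2^n≤4∑goodCount zero          0≢0 = contradiction refl 0≢0
-- For one element `n * (n ∸ 1)` is 0 and cannot be cancelled; the empty sample alone gives 4 on the
-- right against 2.
n!2^n≤4∑goodCount (suc zero)    _   = s≤s (s≤s z≤n)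
n!2^n≤4∑goodCount n@(suc (suc _)) _ = ℕ.*-cancelˡ-≤ (n * (n ∸ 1)) (begin
  n * (n ∸ 1) * (n ! * 2 ^ n)
    ≡⟨ *-swap (n * (n ∸ 1)) (n !) (2 ^ n) ⟩
  n ! * (n * (n ∸ 1) * 2 ^ n)
    ≡⟨ cong (n ! *_) (sym (4∑Cs[n∸s] n)) ⟩
  n ! * (4 * binomialSum n (λ s → s * (n ∸ s)))
    ≡⟨ *-swap (n !) 4 (binomialSum n (λ s → s * (n ∸ s))) ⟩
  4 * (n ! * binomialSum n (λ s → s * (n ∸ s)))
    ≡⟨ cong (4 *_) (sym (binomialSum-*ˡ n (n !) _)) ⟩
  4 * binomialSum n (λ s → n ! * (s * (n ∸ s)))
    ≤⟨ ℕ.*-monoʳ-≤ 4 (∑-mono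
         {g = λ s → (n C s) * (n * (n ∸ 1) * goodCount s (n ∸ s))} (upTo (suc n)) λ s s∈ →
         ℕ.*-monoʳ-≤ (n C s) (ℕ.≤-trans (goodCount-≥ n s (s≤s⁻¹ (∈-upTo⁻ s∈)))
           (ℕ.≤-reflexive (ℕ.*-comm (goodCount s (n ∸ s)) (n * (n ∸ 1)))))) ⟩
  4 * binomialSum n (λ s → n * (n ∸ 1) * goodCount s (n ∸ s))
    ≡⟨ cong (4 *_) (binomialSum-*ˡ n (n * (n ∸ 1)) (λ s → goodCount s (n ∸ s))) ⟩
  4 * (n * (n ∸ 1) * binomialSum n (λ s → goodCount s (n ∸ s)))
    ≡⟨ *-swap 4 (n * (n ∸ 1)) (binomialSum n (λ s → goodCount s (n ∸ s))) ⟩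
  n * (n ∸ 1) * (4 * binomialSum n (λ s → goodCount s (n ∸ s))) ∎)
  where open ℕ.≤-Reasoning

-- From forbidden sets to the competitive ratio

module Competitive (H : Hypergraph m n) (dec : IndepDecider H) (ord : Vec (Fin n) n)
  (arcF : Subset n → Fin n → Pair m)
  (hereditary : ∀ {Q r} → r ∈ OPT H dec ord full → r ∈ Q → r ∈ OPT H dec ord Q)
  (hasForbidden : HasForbiddenSets H dec ord arcF 2) (e : Fin n)
  (e∈OPT : e ∈ OPT H dec ord full) where

  F : Subset n → Subset n → Fin n → Subset n
  F = proj₁ (proj₂ (proj₂ hasForbidden))

  F≤2 : ∀ X Y → e ∈ Y → X ⊆ Y → e ∉ X → ∣ F X Y e ∣ ≤ 2
  F≤2 X Y e∈Y X⊆Y e∉X =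
    proj₂ (proj₁ (proj₂ (proj₂ (proj₂ hasForbidden))) X Y e (hereditary e∈OPT e∈Y) X⊆Y e∉X)

  selected : Vec (Fin n) n → ℕ → ℕ
  selected π s = if does (e ∈? ALG H dec ord arcF π s) then 1 else 0

  module _ (s : ℕ) (s≤n : s ≤ n) where
    open Counting (λ X Y → F X Y e) e F≤2 s

    -- Heredity puts `e` in the optimum of the prefix ending with it. `Good` speaks of splittings
    -- and the forbidden-set property of indices; the two are matched through `take`.
    good⇒∈ALG : ∀ π → Unique (toList π) → Good (toList π) → e ∈ ALG H dec ord arcF π s
    good⇒∈ALG π u (p , q , eq , s≤p , clear) with indexAtSplit π p eq
    ... | t , len , refl , tk = proj₂ (proj₂ (proj₂ (proj₂ hasForbidden))) π u s s≤n t
            (ℕ.≤-trans s≤p (ℕ.≤-reflexive (sym len)))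
            (hereditary e∈OPT (lookup∈prefix π t ℕ.≤-refl))
            unblocked
      where
      unblocked : ∀ j → s ≤ toℕ j → toℕ j < toℕ t →
        lookup π j ∉ F (prefixSet H dec ord π (suc (toℕ j)))
                       (prefixSet H dec ord π (suc (toℕ t))) e
      unblocked j s≤j j<t with splitAtIndex π j
      ... | p′ , q′ , eq′ , len′ , tk′
        with ++-prefix p′ p (trans (sym eq′) eq)
               (ℕ.≤-trans (s≤s (ℕ.≤-reflexive len′)) (ℕ.≤-trans j<t (ℕ.≤-reflexive len)))
      ...   | q″ , p≡ = subst (λ l → lookup π j ∉ F (setOf l) (setOf (take (suc (toℕ t)) (toList π))) e)
        (sym tk′) (subst (λ l → lookup π j ∉ F (setOf (p′ ∷ʳ lookup π j)) (setOf l) e) (sym tk)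
          (clear p′ (lookup π j) q″ p≡ (ℕ.≤-trans s≤j (ℕ.≤-reflexive (sym len′)))))

    goodCount-≤ : goodCount s (n ∸ s) ≤ ∑ (perms n) (λ π → selected π s)
    goodCount-≤ = ℕ.≤-trans (bound (n ∸ s) (sym (ℕ.m∸n+n≡m s≤n)) full (∣⊤∣≡n n) ∈⊤ _ ≥1)
      (ℕ.≤-reflexive (sym (∑-filter (λ v → DU.unique? Fin._≟_ (toList v)) _ (allVecs n n))))
      where
      -- The length is generalised to `k` so that it can be replaced by `d + s` while the ground set
      -- `Fin n` stays fixed.
      bound : ∀ {k} d → k ≡ d + s → ∀ Y → ∣ Y ∣ ≡ k → e ∈ Y → (f : Vec (Fin n) k → ℕ) →
        (∀ v → Enumerates Y (toList v) → Good (toList v) → 1 ≤ f v) →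
        goodCount s d ≤ ∑ (allVecs n k) f
      bound d refl = good-≥ d
      ≥1 : ∀ π → Enumerates full (toList π) → Good (toList π) →
        1 ≤ (if does (DU.unique? Fin._≟_ (toList π)) then selected π s else 0)
      ≥1 π (enumerates u _) good
        rewrite dec-true (DU.unique? Fin._≟_ (toList π)) u
              | dec-true (e ∈? ALG H dec ord arcF π s) (good⇒∈ALG π u good) = ℕ.≤-refl

  competitive : length (perms n) * 2 ^ n ≤ 4 * selWeight H dec ord arcF e
  competitive = begin
    length (perms n) * 2 ^ n
      ≤⟨ ℕ.*-monoˡ-≤ (2 ^ n) (∣perms∣≤n! n) ⟩
    n ! * 2 ^ n
      ≤⟨ n!2^n≤4∑goodCount n (λ { refl → Fin.¬Fin0 e }) ⟩
    4 * binomialSum n (λ s → goodCount s (n ∸ s))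
      ≤⟨ ℕ.*-monoʳ-≤ 4 (∑-mono (upTo (suc n)) λ s s∈ →
           ℕ.*-monoʳ-≤ (n C s) (goodCount-≤ s (s≤s⁻¹ (∈-upTo⁻ s∈)))) ⟩
    4 * binomialSum n (λ s → ∑ (perms n) (λ π → selected π s))
      ≡⟨ cong (4 *_) (∑-cong (upTo (suc n)) λ s → sym (∑-*ˡ (n C s) _ (perms n))) ⟩
    4 * ∑ (upTo (suc n)) (λ s → ∑ (perms n) (λ π → (n C s) * selected π s))
      ≡⟨ cong (4 *_) (∑-swap _ (upTo (suc n)) (perms n)) ⟩
    4 * selWeight H dec ord arcF e ∎
    where open ℕ.≤-Reasoning

theorem6 : {m n : ℕ} (H : Hypergraph m n) (dec : IndepDecider H)
    (ord : Vec (Fin n) n) → Unique (toList ord) →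
    (arcF : Subset n → Fin n → Pair m) → ValidArcs H arcF →
    HasForbiddenSets H dec ord arcF 2 × ProbCompetitiveHalf H dec ord arcF 4
theorem6 H dec ord _ arcF validArcs =
  hasForbiddenSets ,
  Competitive.competitive H dec ord arcF (OPT-hereditary ∅-independent) hasForbiddenSets
  where
  open Forbidden H dec ord arcF validArcs
  open Greedy H dec ord using (OPT-hereditary)
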